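{- Every 3-connected 4-regular simple graph $G$ with an even number of vertices, at most 18, is 3PM-admissible.
   Context: A 3-connected 4-regular graph with an even number of vertices is matching covered (connected, every edge in some perfect matching). A matching covered graph $G$ is 3PM-admissible if there exist three perfect matchings $M_1,M_2,M_3$ of $G$ with $M_1\cap M_2\cap M_3=\emptyset$. -}

module Defs where

open import Data.Nat using (ℕ; suc; _≤_; _<_)
open import Data.Fin using (Fin)
open import Data.Fin.Subset using (Subset; _∈_; _∉_; ∣_∣)
open import Data.List using (List; []; _∷_; length; filter)
open import Data.List.Relation.Unary.All using (All)
open import Data.Product using (Σ; _×_; _,_)
open import Data.Empty using (⊥)
open import Relation.Nullary using (¬_; Dec)
open import Relation.Binary.PropositionalEquality using (_≡_)
open import Relation.Unary using (Decidable)
open import Data.List using (allFin)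

record SimpleGraph (n : ℕ) : Set₁ where
  field
    Adj       : Fin n → Fin n → Set
    adj?      : (u v : Fin n) → Dec (Adj u v)
    sym       : ∀ {u v} → Adj u v → Adj v u
    irrefl    : ∀ {u} → ¬ Adj u u

open SimpleGraph public

degree : ∀ {n} (G : SimpleGraph n) → Fin n → ℕ
degree {n} G v = length (filter (adj? G v) (allFin n))

Regular : ∀ {n} → ℕ → SimpleGraph n → Set
Regular k G = ∀ v → degree G v ≡ k

data Walk {n} (G : SimpleGraph n) : Fin n → Fin n → List (Fin n) → Set where
  here  : ∀ {u} → Walk G u u (u ∷ [])
  step  : ∀ {u w v ws} → Adj G u w → Walk G w v ws → Walk G u v (u ∷ ws)

ConnectedAvoiding : ∀ {n} → SimpleGraph n → Subset n → Set
ConnectedAvoiding {n} G S =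
  ∀ (u v : Fin n) → u ∉ S → v ∉ S →
    Σ (List (Fin n)) λ ws → Walk G u v ws × All (λ x → x ∉ S) ws

KConnected : ∀ {n} → ℕ → SimpleGraph n → Set
KConnected {n} k G = k < n × (∀ (S : Subset n) → ∣ S ∣ < k → ConnectedAvoiding G S)

-- A perfect matching, represented as the map sending each vertex to its unique
-- matched partner: an edge-respecting involution (fixed-point free by irreflexivity).
record PerfectMatching {n} (G : SimpleGraph n) : Set where
  field
    partner     : Fin n → Fin n
    partner-adj : ∀ v → Adj G v (partner v)
    involutive  : ∀ v → partner (partner v) ≡ v

open PerfectMatching public

ThreePMAdmissible : ∀ {n} → SimpleGraph n → Set
ThreePMAdmissible G =
  Σ (PerfectMatching G) λ M₁ → Σ (PerfectMatching G) λ M₂ → Σ (PerfectMatching G) λ M₃ →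
    ∀ v w → partner M₁ v ≡ w → partner M₂ v ≡ w → partner M₃ v ≡ w → ⊥

{-# OPTIONS --safe #-}
-- Odd cuts of G have at least four edges, by 3-connectivity and parity, so Tutte's theorem gives a
-- perfect matching of G minus any edge. Let M₁ be a perfect matching and H = G − M₁, a cubic graph. If
-- H plus some edge e of M₁ has a perfect matching M₂, then M₁ ∩ M₂ ⊆ {e}, and any perfect matching M₃
-- of G − e finishes the proof. Otherwise each H + e has a Tutte barrier, which on at most 18 vertices
-- must be a tripod: a vertex c whose deletion leaves three odd parts of 5 to 7 vertices, each joined
-- to c by one edge of H, with e not running between two parts. Some edge e of M₁ does run between two
-- parts of a first tripod; in the tripod of H + e some part must then contain two whole parts of the
-- first one, that is at least 10 vertices.

module Submission where

open import Defs hiding (sym)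
open import Data.Bool.Base using (true; false)
open import Data.Empty using (⊥)
open import Data.Fin using (Fin; zero; suc; toℕ; fromℕ<; opposite; funToFin; finToFun)
open import Data.Fin.Permutation.Components using (transpose)
open import Data.Fin.Properties using (_≟_; any?; all?; suc-injective; opposite-prop; opposite-involutive; finToFun-funToFin; toℕ<n)
open import Data.Fin.Subset as Subset using (Subset)
open import Data.List as List using (length; filter)
open import Data.List.Relation.Unary.All using (All; _∷_)
open import Data.Nat using (ℕ; zero; suc; _+_; _*_; _∸_; _≤_; _<_; _≤?_; z≤n; s≤s)
open import Data.Nat.Induction using (<-wellFounded)
open import Data.Nat.Properties hiding (_≟_; suc-injective)
import Algebra.Properties.Semiring.Sum +-*-semiring as Sum
open import Data.Nat.Tactic.RingSolver using (solve-∀)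
open import Data.Product using (Σ; ∃; ∃₂; _×_; _,_; proj₁; proj₂)
open import Data.Sum using (_⊎_; inj₁; inj₂; [_,_]′)
open import Data.Vec as Vec using ()
open import Data.Vec.Properties using ([]=⇒lookup; lookup⇒[]=; lookup∘tabulate)
open import Function using (_∘_; id; const)
open import Induction.WellFounded using (Acc; acc)
open import Relation.Binary.PropositionalEquality
open import Relation.Nullary using (¬_; Dec; does; yes; no; _because_; contradiction)
open import Relation.Nullary.Decidable using (_×-dec_; _⊎-dec_; _→-dec_; ¬?; map′; decidable-stable; dec-true; dec-false; toSum)
open import Relation.Unary using (Decidable)

-- The barrier belongs to `H` plus an edge, yet its cuts are counted in the cubic graph `H`; the
-- extra edge enters only through the closure of the parts, which forbids it to join two of them. A
-- barrier set of s vertices comes with s + 2 odd parts, which share at most 3s edges of `H`. A part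
-- of one or three vertices has at least three outgoing edges, so at least three parts have five
-- vertices or more. For s at least 2 this already takes 20 vertices. For s = 1 it takes 16, and the
-- two vertices to spare give the bound 7 on a part. That bound is used twice: a part of one tripod
-- that is split by the other would need 4 + 4 vertices, and a part that swallows two whole parts
-- would need 5 + 5. Arguments by contradiction stay constructive because the existence of a perfect
-- matching is decided by search.

private variable
  n : ℕ
  A B C : Set

-- Finite counting

χ : Dec A → ℕ
χ (true because _) = 1
χ (false because _) = 0

χ-yes : (a : Dec A) → A → χ a ≡ 1
χ-yes (yes _) _ = refl
χ-yes (no ¬x) x = contradiction x ¬x

χ-no : (a : Dec A) → ¬ A → χ a ≡ 0
χ-no (yes x) ¬x = contradiction x ¬x
χ-no (no _) _ = refl

χ≤1 : (a : Dec A) → χ a ≤ 1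
χ≤1 (yes _) = ≤-refl
χ≤1 (no _) = z≤n

χ-mono : (a : Dec A) (b : Dec B) → (A → B) → χ a ≤ χ b
χ-mono (yes x) b f = ≤-reflexive (sym (χ-yes b (f x)))
χ-mono (no _) _ _ = z≤n

χ-cong : (a : Dec A) (b : Dec B) → (A → B) → (B → A) → χ a ≡ χ b
χ-cong a b f g = ≤-antisym (χ-mono a b f) (χ-mono b a g)

χ-excl : (a : Dec A) (b : Dec B) (c : Dec C) → (A → C) → (B → C) → ¬ (A × B) → χ a + χ b ≤ χ c
χ-excl (yes x) (yes y) _ _ _ e = contradiction (x , y) e
χ-excl (yes x) (no _) c f _ _ = ≤-reflexive (sym (χ-yes c (f x)))
χ-excl (no _) b c _ g _ = χ-mono b c g

χ-union : (a : Dec A) (b : Dec B) (c : Dec C) → (C → A ⊎ B) → χ c ≤ χ a + χ b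
χ-union (yes _) b c _ = ≤-trans (χ≤1 c) (m≤m+n 1 (χ b))
χ-union (no ¬x) b c f = χ-mono c b λ z → [ (λ x → contradiction x ¬x) , id ]′ (f z)

χ-× : (a : Dec A) (b : Dec B) → χ (a ×-dec b) ≡ χ a * χ b
χ-× (yes _) (yes _) = refl
χ-× (yes _) (no _) = refl
χ-× (no _) _ = refl

Even : ℕ → Set
Even m = ∃ λ k → m ≡ k + k

Odd : ℕ → Set
Odd m = ∃ λ k → m ≡ suc (k + k)

-- Opaque, so that the arguments of a sum can be inferred from the sum.
opaque
  sum : (Fin n → ℕ) → ℕ
  sum = Sum.sum

  ∑-distrib-+ : (f g : Fin n → ℕ) → sum (λ i → f i + g i) ≡ sum f + sum g
  ∑-distrib-+ = Sum.∑-distrib-+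

  ∑-comm : ∀ {m} (f : Fin m → Fin n → ℕ) → sum (λ i → sum (f i)) ≡ sum (λ j → sum (λ i → f i j))
  ∑-comm = Sum.∑-comm

  sum-cong-≗ : {f g : Fin n → ℕ} → (∀ i → f i ≡ g i) → sum f ≡ sum g
  sum-cong-≗ = Sum.sum-cong-≗

  *-distribˡ-sum : ∀ c (f : Fin n → ℕ) → c * sum f ≡ sum (λ i → c * f i)
  *-distribˡ-sum = Sum.*-distribˡ-sum

  sum-mono : {f g : Fin n → ℕ} → (∀ i → f i ≤ g i) → sum f ≤ sum g
  sum-mono {zero} _ = z≤n
  sum-mono {suc n} f≤g = +-mono-≤ (f≤g zero) (sum-mono (f≤g ∘ suc))

  sum-mono-< : {f g : Fin n → ℕ} → (∀ i → f i ≤ g i) → ∀ j → f j < g j → sum f < sum g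
  sum-mono-< f≤g zero f<g = +-mono-<-≤ f<g (sum-mono (f≤g ∘ suc))
  sum-mono-< f≤g (suc j) f<g = +-mono-≤-< (f≤g zero) (sum-mono-< (f≤g ∘ suc) j f<g)

  sum-const : ∀ c → sum {n} (const c) ≡ n * c
  sum-const {zero} c = refl
  sum-const {suc n} c = cong (c +_) (sum-const {n} c)

  sum-zero : {f : Fin n → ℕ} → (∀ i → f i ≡ 0) → sum f ≡ 0
  sum-zero {n} f≡0 = trans (sum-cong-≗ f≡0) (trans (sum-const {n} 0) (*-zeroʳ n))

  term≤sum : (f : Fin n → ℕ) → ∀ i → f i ≤ sum f
  term≤sum f zero = m≤m+n _ _
  term≤sum f (suc i) = m≤n⇒m≤o+n (f zero) (term≤sum (f ∘ suc) i)

  sum-point : (x : Fin n) (f : Fin n → ℕ) → sum (λ v → χ (v ≟ x) * f v) ≡ f x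
  sum-point zero f = trans (cong₂ _+_ (+-identityʳ (f zero)) (sum-zero {f = λ v → χ (suc v ≟ zero) * f (suc v)} λ _ → refl)) (+-identityʳ (f zero))
  sum-point (suc x) f = trans (sum-cong-≗ λ v → cong (_* f (suc v)) (χ-cong (suc v ≟ suc x) (v ≟ x) suc-injective (cong suc))) (sum-point x (f ∘ suc))

  -- Handshake lemma in matrix form: when vertex `zero` is peeled off, its row and its column
  -- contribute equal amounts.
  symmetric-sum-even : (M : Fin n → Fin n → ℕ) → (∀ u v → M u v ≡ M v u) → (∀ u → M u u ≡ 0) →
                       Even (sum λ u → sum (M u))
  symmetric-sum-even {zero} M _ _ = 0 , refl
  symmetric-sum-even {suc n} M sy di with symmetric-sum-even (λ u v → M (suc u) (suc v)) (λ u v → sy _ _) (λ u → di _)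
  ... | k , eq = sum (M zero ∘ suc) + k , (begin
    (M zero zero + row) + sum (λ u → M (suc u) zero + sum (M (suc u) ∘ suc)) ≡⟨ cong₂ _+_ (cong (_+ row) (di zero)) (∑-distrib-+ (λ u → M (suc u) zero) _) ⟩
    row + (sum (λ u → M (suc u) zero) + sum (λ u → sum (M (suc u) ∘ suc)))   ≡⟨ cong (row +_) (cong₂ _+_ (sum-cong-≗ λ u → sy (suc u) zero) eq) ⟩
    row + (row + (k + k))                                                    ≡⟨ rearrange row k ⟩
    (row + k) + (row + k)                                                    ∎)
    where
    open ≡-Reasoning
    row : ℕ
    row = sum (M zero ∘ suc)
    rearrange : ∀ r k → r + (r + (k + k)) ≡ (r + k) + (r + k)
    rearrange = solve-∀

# : {P : Fin n → Set} → Decidable P → ℕ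
# P? = sum λ v → χ (P? v)

#-point : (x : Fin n) → # (_≟ x) ≡ 1
#-point x = trans (sum-cong-≗ λ v → sym (*-identityʳ _)) (sum-point x (const 1))

#-mono : {P Q : Fin n → Set} (P? : Decidable P) (Q? : Decidable Q) → (∀ v → P v → Q v) → # P? ≤ # Q?
#-mono P? Q? f = sum-mono λ v → χ-mono (P? v) (Q? v) (f v)

#-cong : {P Q : Fin n → Set} (P? : Decidable P) (Q? : Decidable Q) → (∀ v → P v → Q v) → (∀ v → Q v → P v) → # P? ≡ # Q?
#-cong P? Q? f g = ≤-antisym (#-mono P? Q? f) (#-mono Q? P? g)

#-excl : {P Q R : Fin n → Set} (P? : Decidable P) (Q? : Decidable Q) (R? : Decidable R) →
         (∀ v → P v → R v) → (∀ v → Q v → R v) → (∀ v → ¬ (P v × Q v)) → # P? + # Q? ≤ # R?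
#-excl P? Q? R? f g e = ≤-trans (≤-reflexive (sym (∑-distrib-+ (λ v → χ (P? v)) (λ v → χ (Q? v)))))
  (sum-mono λ v → χ-excl (P? v) (Q? v) (R? v) (f v) (g v) (e v))

#-union : {P Q R : Fin n → Set} (P? : Decidable P) (Q? : Decidable Q) (R? : Decidable R) →
          (∀ v → R v → P v ⊎ Q v) → # R? ≤ # P? + # Q?
#-union P? Q? R? f = ≤-trans (sum-mono λ v → χ-union (P? v) (Q? v) (R? v) (f v))
  (≤-reflexive (∑-distrib-+ (λ v → χ (P? v)) (λ v → χ (Q? v))))

#-mono-< : {P Q : Fin n → Set} (P? : Decidable P) (Q? : Decidable Q) → (∀ v → P v → Q v) →
           ∀ w → Q w → ¬ P w → # P? < # Q?
#-mono-< P? Q? f w q ¬p = sum-mono-< (λ v → χ-mono (P? v) (Q? v) (f v)) w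
  (subst₂ _<_ (sym (χ-no (P? w) ¬p)) (sym (χ-yes (Q? w) q)) ≤-refl)

#<#⇒∃ : {P Q : Fin n → Set} (P? : Decidable P) (Q? : Decidable Q) → # P? < # Q? → ∃ λ v → Q v × ¬ P v
#<#⇒∃ P? Q? lt with any? (λ v → Q? v ×-dec ¬? (P? v))
... | yes found = found
... | no none = contradiction (#-mono Q? P? λ v q → decidable-stable (P? v) λ ¬p → none (v , q , ¬p)) (<⇒≱ lt)

0<#⇒∃ : {P : Fin n → Set} (P? : Decidable P) → 0 < # P? → ∃ P
0<#⇒∃ {n} P? pos = let (v , p , _) = #<#⇒∃ {P = λ _ → ⊥} (λ _ → no λ ()) P? (subst (_< # P?) (sym (sum-zero {n} λ _ → refl)) pos) in v , p

#-subsingleton : {P : Fin n → Set} (P? : Decidable P) → (∀ u v → P u → P v → u ≡ v) → # P? ≤ 1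
#-subsingleton P? unique with any? P?
... | yes (x , px) = ≤-trans (#-mono P? (_≟ x) λ v pv → unique v x pv px) (≤-reflexive (#-point x))
... | no none = ≤-trans (≤-reflexive (sum-zero λ v → χ-no (P? v) λ p → none (v , p))) z≤n

module _ {P : Fin n → Set} (P? : Decidable P) (f : Fin n → Fin n)
         (closed : ∀ v → P v → P (f v)) (invol : ∀ v → f (f v) ≡ v) where

  -- The permutation matrix of `f` restricted to `P` is symmetric with zero diagonal, and its
  -- entries add up to the size of `P`.
  fixed-point-free-even : (∀ v → P v → f v ≢ v) → Even (# P?)
  fixed-point-free-even free = subst Even (sum-cong-≗ rows) (symmetric-sum-even M symm diag)
    where
    M : Fin n → Fin n → ℕ
    M v u = χ (P? v ×-dec u ≟ f v)
    symm : ∀ u v → M u v ≡ M v u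
    symm u v = χ-cong (P? u ×-dec v ≟ f u) (P? v ×-dec u ≟ f v) flip′ flip′
      where
      flip′ : ∀ {u v} → P u × v ≡ f u → P v × u ≡ f v
      flip′ {u} (p , refl) = closed u p , sym (invol u)
    diag : ∀ u → M u u ≡ 0
    diag u = χ-no (P? u ×-dec u ≟ f u) λ (p , e) → free u p (sym e)
    rows : ∀ v → sum (M v) ≡ χ (P? v)
    rows v = begin
      sum (M v)                          ≡⟨ sum-cong-≗ (λ u → trans (χ-× (P? v) (u ≟ f v)) (*-comm (χ (P? v)) _)) ⟩
      sum (λ u → χ (u ≟ f v) * χ (P? v)) ≡⟨ sum-point (f v) (const (χ (P? v))) ⟩
      χ (P? v)                           ∎
      where open ≡-Reasoning

#-preimage : {P : Fin n → Set} (P? : Decidable P) (f : Fin n → Fin n) → (∀ v → f (f v) ≡ v) →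
             # (λ v → P? (f v)) ≡ # P?
#-preimage P? f invol = begin
  # (λ v → P? (f v))                               ≡⟨ sum-cong-≗ (λ v → sym (sum-point (f v) (λ u → χ (P? u)))) ⟩
  sum (λ v → sum (λ u → χ (u ≟ f v) * χ (P? u)))   ≡⟨ ∑-comm _ ⟩
  sum (λ u → sum (λ v → χ (u ≟ f v) * χ (P? u)))   ≡⟨ sum-cong-≗ (λ u → sum-cong-≗ λ v → cong (_* χ (P? u)) (χ-cong (u ≟ f v) (v ≟ f u) flip′ flip′)) ⟩
  sum (λ u → sum (λ v → χ (v ≟ f u) * χ (P? u)))   ≡⟨ sum-cong-≗ (λ u → sum-point (f u) (λ _ → χ (P? u))) ⟩
  # P?                                             ∎
  where
  open ≡-Reasoning
  flip′ : ∀ {u v} → u ≡ f v → v ≡ f u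
  flip′ refl = sym (invol _)

sumOver : {P : Fin n → Set} → Decidable P → (Fin n → ℕ) → ℕ
sumOver P? f = sum λ v → χ (P? v) * f v

sumOver-mono : {P : Fin n → Set} (P? : Decidable P) {f g : Fin n → ℕ} →
               (∀ v → P v → f v ≤ g v) → sumOver P? f ≤ sumOver P? g
sumOver-mono P? {f} {g} f≤g = sum-mono pointwise
  where
  pointwise : ∀ v → χ (P? v) * f v ≤ χ (P? v) * g v
  pointwise v with P? v
  ... | yes p = +-monoˡ-≤ 0 (f≤g v p)
  ... | no _ = z≤n

sumOver-+ : {P : Fin n → Set} (P? : Decidable P) (f g : Fin n → ℕ) →
            sumOver P? (λ v → f v + g v) ≡ sumOver P? f + sumOver P? g
sumOver-+ P? f g = trans (sum-cong-≗ λ v → *-distribˡ-+ (χ (P? v)) (f v) (g v)) (∑-distrib-+ _ _)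

sumOver-const : {P : Fin n → Set} (P? : Decidable P) (c : ℕ) → sumOver P? (const c) ≡ c * # P?
sumOver-const P? c = trans (sum-cong-≗ λ v → *-comm (χ (P? v)) c) (sym (*-distribˡ-sum c _))

#-guard : (a : Dec A) {P : Fin n → Set} (P? : Decidable P) → # (λ v → a ×-dec P? v) ≡ χ a * # P?
#-guard a P? = trans (sum-cong-≗ λ v → χ-× a (P? v)) (sym (*-distribˡ-sum (χ a) _))

module _ {T S : Fin n → Set} {D : Fin n → Fin n → Set}
         (T? : Decidable T) (S? : Decidable S) (D? : ∀ t → Decidable (D t))
         (avoid : ∀ t v → T t → D t v → ¬ S v)
         (disjoint : ∀ t t′ v → T t → T t′ → D t v → D t′ v → t ≡ t′) where

  -- After exchanging the sums, `f v` is charged once for each part containing `v` and once if `v`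
  -- lies in `S`; disjointness leaves at most one charge. With `f` constantly 1 this counts
  -- vertices, with `f` the number of neighbours in `S` it counts edges.
  packing : (f : Fin n → ℕ) →
            sumOver T? (λ t → sumOver (D? t) f) + sumOver S? f ≤ sum f
  packing f = begin
    sumOver T? (λ t → sumOver (D? t) f) + sumOver S? f
      ≡⟨ cong (_+ sumOver S? f) (sum-cong-≗ λ t → trans (*-distribˡ-sum (χ (T? t)) _) (sum-cong-≗ λ v → reassoc t v)) ⟩
    sum (λ t → sum (λ v → f v * χ (T? t ×-dec D? t v))) + sumOver S? f
      ≡⟨ cong (_+ sumOver S? f) (trans (∑-comm _) (sum-cong-≗ λ v → sym (*-distribˡ-sum (f v) _))) ⟩
    sum (λ v → f v * # (λ t → T? t ×-dec D? t v)) + sumOver S? f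
      ≡⟨ sym (∑-distrib-+ _ _) ⟩
    sum (λ v → f v * # (λ t → T? t ×-dec D? t v) + χ (S? v) * f v)
      ≤⟨ sum-mono (λ v → ≤-trans (≤-reflexive (factor v)) (≤-trans (*-monoʳ-≤ (f v) (once v)) (≤-reflexive (*-identityʳ (f v))))) ⟩
    sum f ∎
    where
    open ≤-Reasoning
    reassoc : ∀ t v → χ (T? t) * (χ (D? t v) * f v) ≡ f v * χ (T? t ×-dec D? t v)
    reassoc t v = trans (sym (*-assoc (χ (T? t)) _ (f v)))
      (trans (cong (_* f v) (sym (χ-× (T? t) (D? t v)))) (*-comm _ (f v)))
    factor : ∀ v → f v * # (λ t → T? t ×-dec D? t v) + χ (S? v) * f v ≡ f v * (# (λ t → T? t ×-dec D? t v) + χ (S? v))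
    factor v = trans (cong (f v * # (λ t → T? t ×-dec D? t v) +_) (*-comm (χ (S? v)) (f v))) (sym (*-distribˡ-+ (f v) _ _))
    once : ∀ v → # (λ t → T? t ×-dec D? t v) + χ (S? v) ≤ 1
    once v with S? v
    ... | yes s = ≤-reflexive (cong (_+ 1) (sum-zero λ t → χ-no (T? t ×-dec D? t v) λ (τ , d) → avoid t v τ d s))
    ... | no _ = ≤-trans (≤-reflexive (+-identityʳ _))
          (#-subsingleton (λ t → T? t ×-dec D? t v) λ t t′ (τ , d) (τ′ , d′) → disjoint t t′ v τ τ′ d d′)

-- Tutte's theorem

adj-sym : (G : SimpleGraph n) → ∀ {u v} → Adj G u v → Adj G v u
adj-sym G = SimpleGraph.sym G

adj-≢ : (G : SimpleGraph n) → ∀ {u v} → Adj G u v → u ≢ v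
adj-≢ G a refl = irrefl G a

perfectMatching-mono : {G H : SimpleGraph n} → (∀ {u v} → Adj G u v → Adj H u v) → PerfectMatching G → PerfectMatching H
perfectMatching-mono G⊆H M = record { partner = partner M ; partner-adj = λ v → G⊆H (partner-adj M v) ; involutive = involutive M }

-- Exhaustive search over all maps on the vertices, each coded by one number. Only decidability
-- matters: it justifies `decidable-stable` in the later arguments by contradiction.
perfectMatching? : (G : SimpleGraph n) → Dec (PerfectMatching G)
perfectMatching? {n} G = map′ build code
  (any? λ i → all? λ v → adj? G v (finToFun i v) ×-dec finToFun {n} {n} i (finToFun i v) ≟ v)
  where
  Valid : (Fin n → Fin n) → Set
  Valid f = ∀ v → Adj G v (f v) × f (f v) ≡ v
  build : ∃ (λ i → Valid (finToFun {n} {n} i)) → PerfectMatching G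
  build (i , valid) = record { partner = finToFun i ; partner-adj = proj₁ ∘ valid ; involutive = proj₂ ∘ valid }
  code : PerfectMatching G → ∃ (λ i → Valid (finToFun {n} {n} i))
  code M = funToFin (partner M) , λ v →
    subst (Adj G v) (sym (≗p v)) (partner-adj M v) ,
    trans (≗p _) (trans (cong (partner M) (≗p v)) (involutive M v))
    where
    ≗p = finToFun-funToFin (partner M)

transpose-left : (x y : Fin n) → transpose x y x ≡ y
transpose-left x y rewrite dec-true (x ≟ x) refl = refl

transpose-right : (x y : Fin n) → transpose x y y ≡ x
transpose-right x y with y ≟ x
... | yes y≡x = y≡x
... | no _ rewrite dec-true (y ≟ y) refl = refl

transpose-other : (x y : Fin n) {v : Fin n} → v ≢ x → v ≢ y → transpose x y v ≡ v
transpose-other x y {v} v≢x v≢y rewrite dec-false (v ≟ x) v≢x | dec-false (v ≟ y) v≢y = refl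

transpose-involutive : (x y v : Fin n) → transpose x y (transpose x y v) ≡ v
transpose-involutive x y v with v ≟ x
... | yes refl = transpose-right v y
... | no v≢x with v ≟ y
...   | yes refl = transpose-left x v
...   | no v≢y = transpose-other x y v≢x v≢y

-- The vertices missed by the matching are the fixed points of mate.
record NearPerfect (G : SimpleGraph n) (x y : Fin n) : Set where
  field
    mate    : Fin n → Fin n
    mate²   : ∀ v → mate (mate v) ≡ v
    x≢y     : x ≢ y
    missˡ   : mate x ≡ x
    missʳ   : mate y ≡ y
    matched : ∀ v → v ≢ x → v ≢ y → Adj G v (mate v)

open NearPerfect

module _ {G : SimpleGraph n} where

  swap : ∀ {x y} → NearPerfect G x y → NearPerfect G y x
  swap N = record { mate = mate N ; mate² = mate² N ; x≢y = x≢y N ∘ sym ; missˡ = missʳ N ; missʳ = missˡ N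
                  ; matched = λ v v≢y v≢x → matched N v v≢x v≢y }

  mate-injective : ∀ {x y} (N : NearPerfect G x y) → ∀ {u v} → mate N u ≡ mate N v → u ≡ v
  mate-injective N {u} {v} e = trans (sym (mate² N u)) (trans (cong (mate N) e) (mate² N v))

  match : ∀ {x y} → NearPerfect G x y → Adj G x y → PerfectMatching G
  match {x} {y} N xy = record { partner = p ; partner-adj = p-adj ; involutive = p² }
    where
    p : Fin n → Fin n
    p v = mate N (transpose x y v)
    px : p x ≡ y
    px = trans (cong (mate N) (transpose-left x y)) (missʳ N)
    py : p y ≡ x
    py = trans (cong (mate N) (transpose-right x y)) (missˡ N)
    pv : ∀ {v} → v ≢ x → v ≢ y → p v ≡ mate N v
    pv v≢x v≢y = cong (mate N) (transpose-other x y v≢x v≢y)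
    p-adj : ∀ v → Adj G v (p v)
    p-adj v with toSum (v ≟ x)
    ... | inj₁ refl = subst (Adj G v) (sym px) xy
    ... | inj₂ v≢x with toSum (v ≟ y)
    ...   | inj₁ refl = subst (Adj G v) (sym py) (adj-sym G xy)
    ...   | inj₂ v≢y = subst (Adj G v) (sym (pv v≢x v≢y)) (matched N v v≢x v≢y)
    p² : ∀ v → p (p v) ≡ v
    p² v with toSum (v ≟ x)
    ... | inj₁ refl = trans (cong p px) py
    ... | inj₂ v≢x with toSum (v ≟ y)
    ...   | inj₁ refl = trans (cong p py) px
    ...   | inj₂ v≢y = trans (cong p (pv v≢x v≢y)) (trans (pv (λ e → v≢x (mate-injective N (trans e (sym (missˡ N)))))
                       (λ e → v≢y (mate-injective N (trans e (sym (missʳ N)))))) (mate² N v))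

  -- Match x with b and release the former mate of b.
  shift : ∀ {x y} (N : NearPerfect G x y) (b : Fin n) → b ≢ x → b ≢ y → Adj G x b → NearPerfect G (mate N b) y
  shift {x} {y} N b b≢x b≢y xb = record
    { mate = q ; mate² = q² ; x≢y = a≢y ; missˡ = qa ; missʳ = qy ; matched = q-adj }
    where
    a = mate N b
    -- Conjugating the involution by this transposition turns the pair of `a` and `b` into the pair
    -- of `x` and `b`, and the fixed point `x` into `a`.
    τ = transpose x a
    q : Fin n → Fin n
    q v = τ (mate N (τ v))
    q² : ∀ v → q (q v) ≡ v
    q² v = trans (cong (τ ∘ mate N) (transpose-involutive x a _))
      (trans (cong τ (mate² N _)) (transpose-involutive x a v))
    b≢a : b ≢ a
    b≢a = adj-≢ G (matched N b b≢x b≢y)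
    a≢y : a ≢ y
    a≢y e = b≢y (mate-injective N (trans e (sym (missʳ N))))
    qx : q x ≡ b
    qx = trans (cong (τ ∘ mate N) (transpose-left x a)) (trans (cong τ (mate² N b)) (transpose-other x a b≢x b≢a))
    qb : q b ≡ x
    qb = trans (cong (τ ∘ mate N) (transpose-other x a b≢x b≢a)) (transpose-right x a)
    qa : q a ≡ a
    qa = trans (cong (τ ∘ mate N) (transpose-right x a)) (trans (cong τ (missˡ N)) (transpose-left x a))
    qy : q y ≡ y
    qy = trans (cong (τ ∘ mate N) τy) (trans (cong τ (missʳ N)) τy)
      where
      τy : τ y ≡ y
      τy = transpose-other x a (x≢y N ∘ sym) (a≢y ∘ sym)
    q-adj : ∀ v → v ≢ a → v ≢ y → Adj G v (q v)
    q-adj v v≢a v≢y with toSum (v ≟ x)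
    ... | inj₁ refl = subst (Adj G v) (sym qx) xb
    ... | inj₂ v≢x with toSum (v ≟ b)
    ...   | inj₁ refl = subst (Adj G v) (sym qb) (adj-sym G xb)
    ...   | inj₂ v≢b = subst (Adj G v) (sym (trans (cong (τ ∘ mate N) (transpose-other x a v≢x v≢a))
              (transpose-other x a (λ e → v≢x (mate-injective N (trans e (sym (missˡ N))))) (v≢b ∘ mate-injective N))))
              (matched N v v≢x v≢y)

  shift-other : ∀ {x y} (N : NearPerfect G x y) b b≢x b≢y xb {v} →
                v ≢ x → v ≢ mate N b → mate N v ≢ x → v ≢ b → mate (shift N b b≢x b≢y xb) v ≡ mate N v
  shift-other {x} N b _ _ _ v≢x v≢a pv≢x v≢b = trans (cong (transpose x (mate N b) ∘ mate N) (transpose-other x _ v≢x v≢a))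
    (transpose-other x _ pv≢x (v≢b ∘ mate-injective N))

  shift-new : ∀ {x y} (N : NearPerfect G x y) b b≢x b≢y xb → mate (shift N b b≢x b≢y xb) x ≡ b
  shift-new {x} N b b≢x b≢y _ = trans (cong (τ ∘ mate N) (transpose-left x _))
    (trans (cong τ (mate² N b)) (transpose-other x _ b≢x (adj-≢ G (matched N b b≢x b≢y))))
    where
    τ = transpose x (mate N b)

  -- The missed vertex d of Q walks along the alternating path of P and Q;
  -- each step makes Q agree with P on two more vertices.
  crossing-paths : ∀ {a b c d} (P : NearPerfect G a c) (Q : NearPerfect G b d) →
                   Adj G b a → Adj G b c → PerfectMatching G
  crossing-paths {a} {b} {c} P Q ba bc = walk Q (<-wellFounded _)
    where
    p = mate P
    differ? : ∀ {d} (Q : NearPerfect G b d) → Decidable (λ v → mate Q v ≢ p v)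
    differ? Q v = ¬? (mate Q v ≟ p v)
    walk : ∀ {d} (Q : NearPerfect G b d) → Acc _<_ (# (differ? Q)) → PerfectMatching G
    -- The path ends at `a` or `c`, which `ba` and `bc` join to `b`, or at a vertex that `P` matches
    -- with `b`; then the two vertices missed by `Q` are adjacent.
    walk {d} Q (acc smaller) with d ≟ a
    ... | yes refl = match Q ba
    ... | no d≢a with d ≟ c
    ...   | yes refl = match Q bc
    ...   | no d≢c with p d ≟ b
    ...     | yes refl = match Q (adj-sym G (matched P d d≢a d≢c))
    ...     | no e≢b = walk (swap Q′) (smaller (#-mono-< (differ? (swap Q′)) (differ? Q) agree d
                (λ eq → e≢d (trans (sym eq) (missʳ Q))) λ ne → ne (shift-new (swap Q) e e≢d e≢b de)))
      where
      e = p d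
      de : Adj G d e
      de = matched P d d≢a d≢c
      e≢d : e ≢ d
      e≢d = adj-≢ G de ∘ sym
      Q′ = shift (swap Q) e e≢d e≢b de
      agree : ∀ v → mate Q′ v ≢ p v → mate Q v ≢ p v
      agree v differs same = differs (trans (shift-other (swap Q) e e≢d e≢b de v≢d v≢a′ qv≢d v≢e) same)
        where
        qe≢d : mate Q e ≢ d
        qe≢d eq = e≢d (mate-injective Q (trans eq (sym (missʳ Q))))
        v≢d : v ≢ d
        v≢d refl = e≢d (trans (sym same) (missʳ Q))
        v≢e : v ≢ e
        v≢e refl = qe≢d (trans same (mate² P d))
        v≢a′ : v ≢ mate Q e
        v≢a′ refl = qe≢d (mate-injective P (trans (sym same) (mate² Q e)))
        qv≢d : mate Q v ≢ d
        qv≢d eq = v≢d (mate-injective Q (trans eq (sym (missʳ Q))))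

-- S is the Tutte set; D t is meaningful only for t ∈ T.
record Barrier (G : SimpleGraph n) : Set₁ where
  field
    S T      : Fin n → Set
    D        : Fin n → Fin n → Set
    S?       : Decidable S
    T?       : Decidable T
    D?       : ∀ t → Decidable (D t)
    avoid    : ∀ t v → T t → D t v → ¬ S v
    disjoint : ∀ t t′ v → T t → T t′ → D t v → D t′ v → t ≡ t′
    closed   : ∀ t {v u} → T t → D t v → Adj G v u → ¬ S u → D t u
    odd      : ∀ t → T t → Odd (# (D? t))
    surplus  : # T? ≡ # S? + 2

-- Only `closed` mentions edges, and it asks less of a smaller graph. This brings a barrier back
-- from a saturated graph, and lets the cuts of a barrier be counted in a subgraph.
barrier-antitone : {G H : SimpleGraph n} → (∀ {u v} → Adj G u v → Adj H u v) → Barrier H → Barrier G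
barrier-antitone G⊆H B = record
  { S = S ; T = T ; D = D ; S? = S? ; T? = T? ; D? = D? ; avoid = avoid ; disjoint = disjoint
  ; closed = λ t τ d a → closed t τ d (G⊆H a) ; odd = odd ; surplus = surplus }
  where open Barrier B

double≢odd : ∀ k m → 2 * k ≢ suc (m + m)
double≢odd k m eq = even≢odd k m (trans eq (cong (λ z → suc (m + z)) (sym (+-identityʳ m))))

-- Reversing the order of the vertices is an involution; a fixed vertex `v` would make their number
-- 2v + 1.
complete-perfectMatching : (G : SimpleGraph n) (k : ℕ) → n ≡ 2 * k → (∀ u v → u ≢ v → Adj G u v) → PerfectMatching G
complete-perfectMatching G k refl complete = record
  { partner = opposite
  ; partner-adj = λ v → complete v (opposite v) λ eq → double≢odd k (toℕ v) (begin
      2 * k                                      ≡⟨ sym (m∸n+n≡m (toℕ<n v)) ⟩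
      2 * k ∸ suc (toℕ v) + suc (toℕ v)          ≡⟨ cong (_+ suc (toℕ v)) (sym (opposite-prop v)) ⟩
      toℕ (opposite v) + suc (toℕ v)             ≡⟨ cong (λ w → toℕ w + suc (toℕ v)) (sym eq) ⟩
      toℕ v + suc (toℕ v)                        ≡⟨ +-suc (toℕ v) (toℕ v) ⟩
      suc (toℕ v + toℕ v)                        ∎)
  ; involutive = opposite-involutive }
  where open ≡-Reasoning

-- An edge-maximal graph without perfect matchings: its non-universal vertices form disjoint cliques.
module Saturated (G : SimpleGraph n) (no-perfect : ¬ PerfectMatching G)
                 (saturated : ∀ u v → u ≢ v → ¬ Adj G u v → NearPerfect G u v)
                 {x y : Fin n} (N : NearPerfect G x y) where

  p : Fin n → Fin n
  p = mate N

  U : Fin n → Set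
  U v = ∀ w → w ≢ v → Adj G v w

  U? : Decidable U
  U? v = all? λ w → ¬? (w ≟ v) →-dec adj? G v w

  missed-nonadjacent : ∀ {u v} → NearPerfect G u v → ¬ Adj G u v
  missed-nonadjacent M a = no-perfect (match M a)

  missed-¬U : ∀ {u v} → NearPerfect G u v → ¬ U v
  missed-¬U {u} M univ = missed-nonadjacent M (adj-sym G (univ u (x≢y M)))

  -- Since `b` is not universal, it has a non-neighbour `d`. If `a` and `c` were not adjacent,
  -- saturation would give near-perfect matchings missing `a`, `c` and `b`, `d`, and
  -- `crossing-paths` would merge them into a perfect matching.
  adj-trans : ∀ {a b c} → ¬ U b → Adj G a b → Adj G b c → a ≢ c → Adj G a c
  adj-trans {a} {b} {c} ¬ub ab bc a≢c = decidable-stable (adj? G a c) λ ¬ac → ¬ub λ d d≢b →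
    decidable-stable (adj? G b d) λ ¬bd →
      no-perfect (crossing-paths (saturated a c a≢c ¬ac) (saturated b d (d≢b ∘ sym) ¬bd) (adj-sym G ab) bc)

  missed≢U : ∀ {u} → U u → u ≢ x × u ≢ y
  missed≢U univ = (λ { refl → missed-¬U (swap N) univ }) , λ { refl → missed-¬U N univ }

  -- A universal `s` can be rematched with `x`. So the mate of any universal vertex may take over
  -- the role of a missed vertex.
  release : ∀ s → U s → NearPerfect G (p s) y
  release s univ = let (s≢x , s≢y) = missed≢U univ in
    shift N s s≢x s≢y (adj-sym G (univ x (s≢x ∘ sym)))

  U-mate : ∀ s → U s → ¬ U (p s)
  U-mate s univ = missed-¬U (swap (release s univ))

  -- The representatives of the odd cliques: a non-universal vertex that `p` does not match inside
  -- its own clique is either missed or matched with a universal vertex.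
  T : Fin n → Set
  T t = t ≡ x ⊎ t ≡ y ⊎ U (p t)

  T? : Decidable T
  T? t = t ≟ x ⊎-dec t ≟ y ⊎-dec U? (p t)

  T⇒¬U : ∀ {t} → T t → ¬ U t
  T⇒¬U (inj₁ refl) = missed-¬U (swap N)
  T⇒¬U (inj₂ (inj₁ refl)) = missed-¬U N
  T⇒¬U {t} (inj₂ (inj₂ upt)) ut = U-mate t ut upt

  -- Matching `u` with `t` instead would leave the universal vertex `mate M t` missed, against
  -- `missed-¬U`.
  nonadj-mate : ∀ {u v} (M : NearPerfect G u v) {t} → U (mate M t) → t ≢ u → t ≢ v → ¬ Adj G u t
  nonadj-mate M upt t≢u t≢v ut = missed-¬U (swap (shift M _ t≢u t≢v ut)) upt

  mate-U≢missed : ∀ {t} → U (p t) → t ≢ x × t ≢ y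
  mate-U≢missed upt =
    (λ { refl → missed-¬U (swap N) (subst U (missˡ N) upt) }) , (λ { refl → missed-¬U N (subst U (missʳ N) upt) })

  T-independent : ∀ {t t′} → T t → T t′ → ¬ Adj G t t′
  T-independent (inj₁ refl) (inj₁ refl) = irrefl G
  T-independent (inj₁ refl) (inj₂ (inj₁ refl)) = missed-nonadjacent N
  T-independent (inj₁ refl) (inj₂ (inj₂ u)) = let (≢x , ≢y) = mate-U≢missed u in nonadj-mate N u ≢x ≢y
  T-independent (inj₂ (inj₁ refl)) (inj₁ refl) = missed-nonadjacent (swap N)
  T-independent (inj₂ (inj₁ refl)) (inj₂ (inj₁ refl)) = irrefl G
  T-independent (inj₂ (inj₁ refl)) (inj₂ (inj₂ u)) = let (≢x , ≢y) = mate-U≢missed u in nonadj-mate (swap N) u ≢y ≢x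
  T-independent (inj₂ (inj₂ u)) (inj₁ refl) = T-independent (inj₁ refl) (inj₂ (inj₂ u)) ∘ adj-sym G
  T-independent (inj₂ (inj₂ u)) (inj₂ (inj₁ refl)) = T-independent (inj₂ (inj₁ refl)) (inj₂ (inj₂ u)) ∘ adj-sym G
  -- Releasing `t` makes it a missed vertex, which reduces this case to `nonadj-mate`. The release
  -- affects only `x`, `p t` and `t`, so `t′` keeps its universal mate.
  T-independent {t} {t′} (inj₂ (inj₂ u)) (inj₂ (inj₂ u′)) tt′ =
    nonadj-mate M (subst U (sym same) u′) t′≢pp t′≢y (subst (λ w → Adj G w t′) (sym (mate² N t)) tt′)
    where
    M = release (p t) u
    t≢t′ = adj-≢ G tt′
    t′≢x = proj₁ (mate-U≢missed u′)
    t′≢y = proj₂ (mate-U≢missed u′)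
    t′≢pp : t′ ≢ p (p t)
    t′≢pp e = t≢t′ (sym (trans e (mate² N t)))
    same : mate M t′ ≡ p t′
    same = shift-other N (p t) (proj₁ (missed≢U u)) (proj₂ (missed≢U u)) (adj-sym G (u x (proj₁ (missed≢U u) ∘ sym))) t′≢x t′≢pp
      (λ e → t′≢x (mate-injective N (trans e (sym (missˡ N)))))
      (λ e → T⇒¬U (inj₂ (inj₂ u′)) (subst U (sym e) u))

  -- By `adj-trans` the component of `t` among the non-universal vertices is a clique, so adjacency
  -- to `t` replaces reachability.
  D : Fin n → Fin n → Set
  D t v = ¬ U v × (v ≡ t ⊎ Adj G t v)

  D? : ∀ t → Decidable (D t)
  D? t v = ¬? (U? v) ×-dec (v ≟ t ⊎-dec adj? G t v)

  D-closed : ∀ t {v u} → T t → D t v → Adj G v u → ¬ U u → D t u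
  D-closed t τ (¬uv , inj₁ refl) vu ¬uu = ¬uu , inj₂ vu
  D-closed t {v} {u} τ (¬uv , inj₂ tv) vu ¬uu with u ≟ t
  ... | yes u≡t = ¬uu , inj₁ u≡t
  ... | no u≢t = ¬uu , inj₂ (adj-trans ¬uv tv vu (u≢t ∘ sym))

  D-disjoint : ∀ t t′ v → T t → T t′ → D t v → D t′ v → t ≡ t′
  D-disjoint t t′ v τ τ′ (_ , inj₁ refl) (_ , inj₁ refl) = refl
  D-disjoint t t′ v τ τ′ (_ , inj₁ refl) (_ , inj₂ a′) = contradiction a′ (T-independent τ′ τ)
  D-disjoint t t′ v τ τ′ (_ , inj₂ a) (_ , inj₁ refl) = contradiction a (T-independent τ τ′)
  D-disjoint t t′ v τ τ′ (¬u , inj₂ a) (_ , inj₂ a′) =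
    decidable-stable (t ≟ t′) λ t≢t′ → T-independent τ τ′ (adj-trans ¬u a (adj-sym G a′) t≢t′)

  module _ (t : Fin n) (τ : T t) where
    private
      rest? : Decidable (λ v → D t v × v ≢ t)
      rest? v = D? t v ×-dec ¬? (v ≟ t)
      ¬T : ∀ {v} → D t v → v ≢ t → ¬ T v
      ¬T (_ , inj₁ v≡t) v≢t = contradiction v≡t v≢t
      ¬T (_ , inj₂ tv) _ τv = T-independent τ τv tv
      edge : ∀ v → D t v → v ≢ t → Adj G v (p v)
      edge v d v≢t = matched N v (¬T d v≢t ∘ inj₁) (¬T d v≢t ∘ inj₂ ∘ inj₁)
      p≢t : ∀ v → D t v → v ≢ t → p v ≢ t
      p≢t v d v≢t refl = case τ
        where
        case : ¬ T (p v)
        case (inj₁ e) = v≢t (mate-injective N (trans e (trans (sym (missˡ N)) (cong p (sym e)))))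
        case (inj₂ (inj₁ e)) = v≢t (mate-injective N (trans e (trans (sym (missʳ N)) (cong p (sym e)))))
        case (inj₂ (inj₂ u)) = proj₁ d (subst U (mate² N v) u)
      rest-closed : ∀ v → D t v × v ≢ t → D t (p v) × p v ≢ t
      rest-closed v (d , v≢t) = D-closed t τ d (edge v d v≢t) (¬T d v≢t ∘ inj₂ ∘ inj₂) , p≢t v d v≢t
      rest-free : ∀ v → D t v × v ≢ t → p v ≢ v
      rest-free v (d , v≢t) e = adj-≢ G (edge v d v≢t) (sym e)

    -- `p` pairs off all vertices of the clique other than `t`: by independence of `T`, none of them
    -- is missed or matched with a universal vertex.
    D-odd : Odd (# (D? t))
    D-odd = let (k , eq) = fixed-point-free-even rest? p rest-closed (mate² N) rest-free in k , (begin
      # (D? t)            ≡⟨ ≤-antisym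
          (#-union (_≟ t) rest? (D? t) λ v d → [ inj₁ , (λ ≢t → inj₂ (d , ≢t)) ]′ (toSum (v ≟ t)))
          (#-excl (_≟ t) rest? (D? t) (λ { v refl → T⇒¬U τ , inj₁ refl }) (λ v → proj₁) λ { v (refl , _ , ≢t) → ≢t refl }) ⟩
      # (_≟ t) + # rest?  ≡⟨ cong₂ _+_ (#-point t) eq ⟩
      suc (k + k)         ∎)
      where open ≡-Reasoning

  -- `p` is a bijection, so there are as many mates of universal vertices as universal vertices; the
  -- 2 stands for `x` and `y`.
  T-surplus : # T? ≡ # U? + 2
  T-surplus = begin
    # T?                                               ≡⟨ sum-cong-≗ split ⟩
    sum (λ t → χ (t ≟ x) + (χ (t ≟ y) + χ (U? (p t)))) ≡⟨ ∑-distrib-+ _ _ ⟩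
    # (_≟ x) + sum (λ t → χ (t ≟ y) + χ (U? (p t)))    ≡⟨ cong₂ _+_ (#-point x) (∑-distrib-+ _ _) ⟩
    1 + (# (_≟ y) + # (λ t → U? (p t)))                ≡⟨ cong suc (cong₂ _+_ (#-point y) (#-preimage U? p (mate² N))) ⟩
    2 + # U?                                           ≡⟨ +-comm 2 _ ⟩
    # U? + 2                                           ∎
    where
    open ≡-Reasoning
    χ-⊎ : ∀ {A B : Set} (a : Dec A) (b : Dec B) → ¬ (A × B) → χ (a ⊎-dec b) ≡ χ a + χ b
    χ-⊎ a b e = ≤-antisym (χ-union a b (a ⊎-dec b) id) (χ-excl a b (a ⊎-dec b) inj₁ inj₂ e)
    split : ∀ t → χ (T? t) ≡ χ (t ≟ x) + (χ (t ≟ y) + χ (U? (p t)))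
    split t = trans (χ-⊎ (t ≟ x) (t ≟ y ⊎-dec U? (p t))
        λ { (refl , inj₁ e) → x≢y N e ; (refl , inj₂ u) → proj₁ (mate-U≢missed u) refl })
      (cong (χ (t ≟ x) +_) (χ-⊎ (t ≟ y) (U? (p t)) λ { (refl , u) → proj₂ (mate-U≢missed u) refl }))

  barrier : Barrier G
  barrier = record
    { S = U ; T = T ; D = D ; S? = U? ; T? = T? ; D? = D? ; avoid = λ _ _ _ d → proj₁ d
    ; disjoint = D-disjoint ; closed = D-closed ; odd = D-odd ; surplus = T-surplus }

-- Saturating a graph without perfect matchings

addEdge : (G : SimpleGraph n) (u v : Fin n) → u ≢ v → SimpleGraph n
addEdge G u v u≢v = record
  { Adj    = λ a b → Adj G a b ⊎ (a ≡ u × b ≡ v) ⊎ (a ≡ v × b ≡ u)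
  ; adj?   = λ a b → adj? G a b ⊎-dec (a ≟ u ×-dec b ≟ v) ⊎-dec (a ≟ v ×-dec b ≟ u)
  ; sym    = λ { (inj₁ e) → inj₁ (adj-sym G e) ; (inj₂ (inj₁ (p , q))) → inj₂ (inj₂ (q , p)) ; (inj₂ (inj₂ (p , q))) → inj₂ (inj₁ (q , p)) }
  ; irrefl = λ { (inj₁ e) → irrefl G e ; (inj₂ (inj₁ (refl , q))) → u≢v q ; (inj₂ (inj₂ (refl , q))) → u≢v (sym q) }
  }

module _ (G : SimpleGraph n) (u v : Fin n) (u≢v : u ≢ v) (no-perfect : ¬ PerfectMatching G)
         (M : PerfectMatching (addEdge G u v u≢v)) where
  private
    p = partner M

    old : ∀ w → w ≢ u ⊎ p w ≢ v → w ≢ v ⊎ p w ≢ u → Adj G w (p w)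
    old w h h′ with partner-adj M w
    ... | inj₁ a = a
    ... | inj₂ (inj₁ (e , f)) = contradiction h λ { (inj₁ ne) → ne e ; (inj₂ ne) → ne f }
    ... | inj₂ (inj₂ (e , f)) = contradiction h′ λ { (inj₁ ne) → ne e ; (inj₂ ne) → ne f }

    pu≡v : p u ≡ v
    pu≡v = decidable-stable (p u ≟ v) λ pu≢v → no-perfect record
      { partner = p
      ; partner-adj = λ w → old w
          ([ (λ { refl → inj₂ pu≢v }) , inj₁ ]′ (toSum (w ≟ u)))
          ([ (λ { refl → inj₂ λ e → pu≢v (trans (cong p (sym e)) (involutive M v)) }) , inj₁ ]′ (toSum (w ≟ v)))
      ; involutive = involutive M }

    pv≡u : p v ≡ u
    pv≡u = trans (cong p (sym pu≡v)) (involutive M u)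

    τ = transpose u v

    τp≡pτ : ∀ w → τ (p w) ≡ p (τ w)
    τp≡pτ w with toSum (w ≟ u)
    ... | inj₁ refl = trans (cong τ pu≡v) (trans (transpose-right w v) (sym (trans (cong p (transpose-left w v)) pv≡u)))
    ... | inj₂ w≢u with toSum (w ≟ v)
    ...   | inj₁ refl = trans (cong τ pv≡u) (trans (transpose-left u w) (sym (trans (cong p (transpose-right u w)) pu≡v)))
    ...   | inj₂ w≢v = trans (transpose-other u v
              (λ e → w≢v (trans (sym (involutive M w)) (trans (cong p e) pu≡v)))
              (λ e → w≢u (trans (sym (involutive M w)) (trans (cong p e) pv≡u))))
              (cong p (sym (transpose-other u v w≢u w≢v)))

  -- `M` must use the new edge, since otherwise it would already be a perfect matching of `G`.
  -- Composing with the transposition of `u` and `v` undoes exactly that pair.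
  unmatch : NearPerfect G u v
  unmatch = record
    { mate    = λ w → p (τ w)
    ; mate²   = λ w → trans (cong p (τp≡pτ (τ w))) (trans (involutive M _) (transpose-involutive u v w))
    ; x≢y     = u≢v
    ; missˡ   = trans (cong p (transpose-left u v)) pv≡u
    ; missʳ   = trans (cong p (transpose-right u v)) pu≡v
    ; matched = λ w w≢u w≢v → subst (Adj G w) (cong p (sym (transpose-other u v w≢u w≢v))) (old w (inj₁ w≢u) (inj₁ w≢v))
    }

module _ (G : SimpleGraph n) where
  private
    Addable : Fin n → Fin n → Set
    Addable u v = ¬ Adj G u v × ∃ λ (u≢v : u ≢ v) → ¬ PerfectMatching (addEdge G u v u≢v)

  addable? : ∀ u v → Dec (Addable u v)
  addable? u v with u ≟ v
  ... | yes u≡v = no λ (_ , u≢v , _) → u≢v u≡v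
  ... | no u≢v = ¬? (adj? G u v) ×-dec
        -- The proof of distinctness enters `addEdge` only through irreflexivity, so two such proofs
        -- give the same adjacency.
        map′ (u≢v ,_) (λ (h , none) M → none (perfectMatching-mono (λ e → e) M)) (¬? (perfectMatching? (addEdge G u v u≢v)))

-- Lovász's proof, by saturating the graph.
tutte : (G : SimpleGraph n) (k : ℕ) → n ≡ 2 * k → ¬ PerfectMatching G → Barrier G
tutte {n} G k even = saturate G (<-wellFounded _)
  where
  non-edges : SimpleGraph n → ℕ
  non-edges G = sum λ u → # λ v → ¬? (adj? G u v)

  fewer : (G : SimpleGraph n) (u v : Fin n) (u≢v : u ≢ v) → ¬ Adj G u v → non-edges (addEdge G u v u≢v) < non-edges G
  fewer G u v u≢v ¬uv = sum-mono-< (λ a → #-mono (λ b → ¬? (adj? G⁺ a b)) (λ b → ¬? (adj? G a b)) (shrink a)) u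
      (#-mono-< (λ b → ¬? (adj? G⁺ u b)) (λ b → ¬? (adj? G u b)) (shrink u) v ¬uv λ ¬e → ¬e (inj₂ (inj₁ (refl , refl))))
    where
    G⁺ = addEdge G u v u≢v
    shrink : ∀ a b → ¬ Adj G⁺ a b → ¬ Adj G a b
    shrink a b ¬e e = ¬e (inj₁ e)

  saturate : (G : SimpleGraph n) → Acc _<_ (non-edges G) → ¬ PerfectMatching G → Barrier G
  saturate G (acc smaller) no-perfect with any? (λ u → any? (λ v → addable? G u v))
  ... | yes (u , v , ¬uv , u≢v , none) =
        barrier-antitone inj₁ (saturate (addEdge G u v u≢v) (smaller (fewer G u v u≢v ¬uv)) none)
  ... | no none with any? (λ u → any? (λ v → ¬? (u ≟ v) ×-dec ¬? (adj? G u v)))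
  ...   | no complete = contradiction (complete-perfectMatching G k even λ u v u≢v →
          decidable-stable (adj? G u v) λ ¬uv → complete (u , v , u≢v , ¬uv)) no-perfect
  ...   | yes (x , y , x≢y , ¬xy) = Saturated.barrier G no-perfect near (near x y x≢y ¬xy)
    where
    near : ∀ u v → u ≢ v → ¬ Adj G u v → NearPerfect G u v
    near u v u≢v ¬uv = unmatch G u v u≢v no-perfect
      (decidable-stable (perfectMatching? (addEdge G u v u≢v)) λ no-PM → none (u , v , ¬uv , u≢v , no-PM))

-- Cuts

deg : (G : SimpleGraph n) → Fin n → ℕ
deg G v = # (adj? G v)

opaque
  unfolding sum

  length-filter-tabulate : {A : Set} {P : A → Set} (P? : Decidable P) (f : Fin n → A) →
                           length (filter P? (List.tabulate f)) ≡ # (λ i → P? (f i))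
  length-filter-tabulate {zero} P? f = refl
  length-filter-tabulate {suc n} P? f with P? (f zero)
  ... | yes _ = cong suc (length-filter-tabulate P? (f ∘ suc))
  ... | no _ = length-filter-tabulate P? (f ∘ suc)

  ∣tabulate∣ : {P : Fin n → Set} (P? : Decidable P) → Subset.∣ Vec.tabulate (λ v → does (P? v)) ∣ ≡ # P?
  ∣tabulate∣ {zero} P? = refl
  ∣tabulate∣ {suc n} P? with P? zero
  ... | yes _ = cong suc (∣tabulate∣ (λ v → P? (suc v)))
  ... | no _ = ∣tabulate∣ (λ v → P? (suc v))

degree≡deg : (G : SimpleGraph n) → ∀ v → degree G v ≡ deg G v
degree≡deg G v = length-filter-tabulate (adj? G v) id

odd+even : ∀ {i j} → Odd i → Even j → Odd (i + j)
odd+even (k , refl) (l , refl) = k + l , rearrange k l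
  where
  rearrange : ∀ k l → suc (k + k) + (l + l) ≡ suc ((k + l) + (k + l))
  rearrange = solve-∀

parity : ∀ m → Even m ⊎ Odd m
parity zero = inj₁ (0 , refl)
parity (suc m) with parity m
... | inj₁ (k , eq) = inj₂ (k , cong suc eq)
... | inj₂ (k , eq) = inj₁ (suc k , trans (cong suc eq) (cong suc (sym (+-suc k k))))

¬even∧odd : ∀ {m} → Even m → ¬ Odd m
¬even∧odd (k , refl) (l , eq) = double≢odd k l (trans (cong (k +_) (+-identityʳ k)) eq)

4*-even : ∀ m → Even (m * 4)
4*-even m = 2 * m , rearrange m
  where
  rearrange : ∀ m → m * 4 ≡ 2 * m + 2 * m
  rearrange = solve-∀

3*odd-odd : ∀ {m} → Odd m → Odd (m * 3)
3*odd-odd (k , refl) = suc (3 * k) , rearrange k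
  where
  rearrange : ∀ k → suc (k + k) * 3 ≡ suc (suc (3 * k) + suc (3 * k))
  rearrange = solve-∀

module Cut (G : SimpleGraph n) {P : Fin n → Set} (P? : Decidable P) where

  outward inward : Fin n → ℕ
  outward v = # λ u → ¬? (P? u) ×-dec adj? G v u
  inward v = # λ u → P? u ×-dec adj? G v u

  cut inside : ℕ
  cut = sumOver P? outward
  inside = sumOver P? inward

  out+in : ∀ v → outward v + inward v ≡ deg G v
  out+in v = ≤-antisym
    (#-excl (λ u → ¬? (P? u) ×-dec adj? G v u) (λ u → P? u ×-dec adj? G v u) (adj? G v)
      (λ _ → proj₂) (λ _ → proj₂) λ u ((¬p , _) , p , _) → ¬p p)
    (#-union (λ u → ¬? (P? u) ×-dec adj? G v u) (λ u → P? u ×-dec adj? G v u) (adj? G v)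
      λ u a → [ (λ p → inj₂ (p , a)) , (λ ¬p → inj₁ (¬p , a)) ]′ (toSum (P? u)))

  cut+inside : ∀ r → (∀ v → deg G v ≡ r) → cut + inside ≡ # P? * r
  cut+inside r regular = begin
    cut + inside                              ≡⟨ sym (sumOver-+ P? outward inward) ⟩
    sumOver P? (λ v → outward v + inward v)   ≡⟨ sum-cong-≗ (λ v → cong (χ (P? v) *_) (trans (out+in v) (regular v))) ⟩
    sumOver P? (const r)                      ≡⟨ sumOver-const P? r ⟩
    r * # P?                                  ≡⟨ *-comm r _ ⟩
    # P? * r                                  ∎
    where open ≡-Reasoning

  inside-even : Even inside
  inside-even = subst Even (sum-cong-≗ λ v → #-guard (P? v) (λ u → P? u ×-dec adj? G v u))
    (symmetric-sum-even (λ v u → χ (P? v ×-dec P? u ×-dec adj? G v u))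
      (λ v u → χ-cong (P? v ×-dec P? u ×-dec adj? G v u) (P? u ×-dec P? v ×-dec adj? G u v) flip′ flip′)
      (λ v → χ-no (P? v ×-dec P? v ×-dec adj? G v v) λ (_ , _ , a) → irrefl G a))
    where
    flip′ : ∀ {v u} → P v × P u × Adj G v u → P u × P v × Adj G u v
    flip′ (p , q , a) = q , p , adj-sym G a

  -- The bound d(d - 1) on the degree sum inside d vertices, written without truncated subtraction.
  inside-small : inside + # P? ≤ # P? * # P?
  inside-small = begin
    inside + # P?                            ≡⟨ cong (inside +_) (sym (trans (sumOver-const P? 1) (*-identityˡ _))) ⟩
    inside + sumOver P? (const 1)            ≡⟨ sym (sumOver-+ P? inward (const 1)) ⟩
    sumOver P? (λ v → inward v + 1)          ≤⟨ sumOver-mono P? (λ v p → ≤-trans (≤-reflexive (cong (inward v +_) (sym (#-point v))))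
        (#-excl (λ u → P? u ×-dec adj? G v u) (_≟ v) P? (λ _ → proj₁) (λ { _ refl → p }) λ { _ ((_ , a) , refl) → irrefl G a })) ⟩
    sumOver P? (const (# P?))                ≡⟨ sumOver-const P? (# P?) ⟩
    # P? * # P?                              ∎
    where open ≤-Reasoning

  boundary? : Decidable (λ v → P v × ∃ λ u → ¬ P u × Adj G v u)
  boundary? v = P? v ×-dec any? λ u → ¬? (P? u) ×-dec adj? G v u

  boundary≤cut : # boundary? ≤ cut
  boundary≤cut = sum-mono λ v → bound v
    where
    bound : ∀ v → χ (boundary? v) ≤ χ (P? v) * outward v
    bound v with boundary? v
    ... | no _ = z≤n
    ... | yes (p , u , out) = subst (λ c → 1 ≤ c * outward v) (sym (χ-yes (P? v) p))
          (≤-trans (≤-reflexive (sym (χ-yes (¬? (P? u) ×-dec adj? G v u) out)))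
            (≤-trans (term≤sum _ u) (≤-reflexive (sym (*-identityˡ _)))))

  -- Deleting the endpoints in P of fewer than k cut edges would separate P from its complement.
  connected⇒cut : ∀ {k} → KConnected k G → k ≤ # P? → ∀ w → ¬ P w → k ≤ cut
  connected⇒cut {k} (_ , connected) k≤#P w ¬pw = ≮⇒≥ separated
    where
    separator : Subset.Subset n
    separator = Vec.tabulate (λ v → does (boundary? v))
    out⇒∉ : ∀ {v} → ¬ (P v × ∃ λ u → ¬ P u × Adj G v u) → v Subset.∉ separator
    out⇒∉ {v} ¬b v∈ = contradiction (trans (sym ([]=⇒lookup v∈)) (trans (lookup∘tabulate _ v) (dec-false (boundary? v) ¬b))) λ ()
    ∉⇒out : ∀ {v} → v Subset.∉ separator → ¬ (P v × ∃ λ u → ¬ P u × Adj G v u)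
    ∉⇒out {v} v∉ b = v∉ (lookup⇒[]= v separator (trans (lookup∘tabulate _ v) (dec-true (boundary? v) b)))
    stay : ∀ {u ws} → P u → Walk G u w ws → All (Subset._∉ separator) ws → ¬ ¬ P w
    stay p here _ ¬pw = ¬pw p
    stay p (step {w = u′} a walk) (u∉ ∷ rest) with P? u′
    ... | yes p′ = stay p′ walk rest
    ... | no ¬p′ = contradiction (p , u′ , ¬p′ , a) (∉⇒out u∉)
    separated : ¬ cut < k
    -- Having at least `k` vertices, `P` keeps one of them, `v`, after the deletion; a surviving
    -- walk from `v` to `w` would have to leave `P` at a deleted vertex.
    separated cut<k with #<#⇒∃ boundary? P? (<-≤-trans small k≤#P)
      where
      small : # boundary? < k
      small = ≤-<-trans boundary≤cut cut<k
    ... | v , p , interior =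
      let (_ , walk , avoids) = connected separator
            (≤-<-trans (≤-trans (≤-reflexive (∣tabulate∣ boundary?)) boundary≤cut) cut<k) v w
            (out⇒∉ interior) (out⇒∉ (¬pw ∘ proj₁))
      in stay p walk avoids ¬pw

  private
    singleton-inside : # P? ≡ 1 → inside ≡ 0
    singleton-inside eq = n≤0⇒n≡0 (+-cancelʳ-≤ 1 inside 0 (subst (λ d → inside + d ≤ d * d) eq inside-small))

  singleton-cut : ∀ r → (∀ v → deg G v ≡ r) → # P? ≡ 1 → cut ≡ r
  singleton-cut r regular eq = begin
    cut            ≡⟨ sym (+-identityʳ cut) ⟩
    cut + 0        ≡⟨ cong (cut +_) (sym (singleton-inside eq)) ⟩
    cut + inside   ≡⟨ cut+inside r regular ⟩
    # P? * r       ≡⟨ cong (_* r) eq ⟩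
    1 * r          ≡⟨ *-identityˡ r ⟩
    r              ∎
    where open ≡-Reasoning

  -- The cut has the parity of `# P? * 4`, so it cannot be 3. The connectivity bound requires at
  -- least three vertices in `P`, so a single vertex is treated apart.
  quartic-odd-cut : KConnected 3 G → (∀ v → deg G v ≡ 4) → Odd (# P?) → ∀ w → ¬ P w → 4 ≤ cut
  quartic-odd-cut connected regular (zero , eq) w ¬pw = ≤-reflexive (sym (singleton-cut 4 regular eq))
  quartic-odd-cut connected regular (suc k , eq) w ¬pw = ≤∧≢⇒< (connected⇒cut connected 3≤#P w ¬pw) λ 3≡cut →
    ¬even∧odd (4*-even (# P?)) (subst Odd (cut+inside 4 regular) (odd+even (subst Odd 3≡cut (1 , refl)) inside-even))
    where
    3≤#P : 3 ≤ # P?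
    3≤#P = ≤-trans (s≤s (s≤s (≤-trans (s≤s z≤n) (m≤n+m (suc k) k)))) (≤-reflexive (sym eq))

  cubic-odd-cut : (∀ v → deg G v ≡ 3) → Odd (# P?) → Odd cut
  cubic-odd-cut regular odd with parity cut
  ... | inj₂ cut-odd = cut-odd
  ... | inj₁ (k , eq) with inside-even
  ...   | l , eq′ = contradiction (3*odd-odd odd) (¬even∧odd (k + l , (begin
          # P? * 3                 ≡⟨ sym (cut+inside 3 regular) ⟩
          cut + inside             ≡⟨ cong₂ _+_ eq eq′ ⟩
          (k + k) + (l + l)        ≡⟨ rearrange k l ⟩
          (k + l) + (k + l)        ∎)))
    where
    open ≡-Reasoning
    rearrange : ∀ k l → (k + k) + (l + l) ≡ (k + l) + (k + l)
    rearrange = solve-∀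

  -- One vertex sends out three edges; three vertices have degree sum 9, of which at most 6 stays
  -- inside. For five or more vertices only oddness gives a bound, namely 1, and the term 2 makes up
  -- the difference.
  cubic-small-cut : (∀ v → deg G v ≡ 3) → Odd (# P?) → 3 ≤ cut + 2 * χ (5 ≤? # P?)
  cubic-small-cut regular odd with 5 ≤? # P?
  ... | yes _ with cubic-odd-cut regular odd
  ...   | k , eq = subst (λ c → 3 ≤ c + 2) (sym eq) (s≤s (m≤n+m 2 (k + k)))
  cubic-small-cut regular (zero , eq) | no _ =
    ≤-reflexive (sym (trans (+-identityʳ cut) (singleton-cut 3 regular eq)))
  cubic-small-cut regular (suc zero , eq) | no _ = ≤-trans (+-cancelʳ-≤ inside 3 cut (begin
      3 + inside      ≤⟨ +-monoʳ-≤ 3 (+-cancelʳ-≤ 3 inside 6 (subst (λ d → inside + d ≤ d * d) eq inside-small)) ⟩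
      9               ≡⟨ cong (_* 3) (sym eq) ⟩
      # P? * 3        ≡⟨ sym (cut+inside 3 regular) ⟩
      cut + inside    ∎)) (m≤m+n cut 0)
    where open ≤-Reasoning
  cubic-small-cut regular (suc (suc k) , eq) | no ≱5 = contradiction
    (≤-trans (s≤s (s≤s (s≤s (≤-trans (s≤s (s≤s z≤n)) (m≤n+m (suc (suc k)) k))))) (≤-reflexive (sym eq))) ≱5

sum-degree-into : (G : SimpleGraph n) {S : Fin n → Set} (S? : Decidable S) →
                  sum (λ v → # λ u → S? u ×-dec adj? G v u) ≡ sumOver S? (deg G)
sum-degree-into G S? = begin
  sum (λ v → # λ u → S? u ×-dec adj? G v u) ≡⟨ ∑-comm _ ⟩
  sum (λ u → # λ v → S? u ×-dec adj? G v u) ≡⟨ sum-cong-≗ (λ u → trans (#-guard (S? u) (λ v → adj? G v u))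
      (cong (χ (S? u) *_) (#-cong (λ v → adj? G v u) (adj? G u) (λ _ → adj-sym G) (λ _ → adj-sym G)))) ⟩
  sumOver S? (deg G) ∎
  where open ≡-Reasoning

-- Perfect matchings avoiding an edge

module BarrierCounting (G : SimpleGraph n) (B : Barrier G) where
  open Barrier B

  intoS : Fin n → ℕ
  intoS v = # λ u → S? u ×-dec adj? G v u

  weigh : (f w : Fin n → ℕ) → (∀ t → T t → w t ≤ sumOver (D? t) f) → sumOver T? w + sumOver S? f ≤ sum f
  weigh f w w≤ = ≤-trans (+-monoˡ-≤ (sumOver S? f) (sumOver-mono T? w≤)) (packing T? S? D? avoid disjoint f)

  outward≤intoS : ∀ t {v} → T t → D t v → Cut.outward G (D? t) v ≤ intoS v
  outward≤intoS t {v} τ d = #-mono (λ u → ¬? (D? t u) ×-dec adj? G v u) (λ u → S? u ×-dec adj? G v u)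
    λ u (¬d , a) → decidable-stable (S? u) (λ ¬s → ¬d (closed t τ d a ¬s)) , a

  inhabited : ∀ t → T t → ∃ (D t)
  inhabited t τ = 0<#⇒∃ (D? t) (subst (0 <_) (sym (proj₂ (odd t τ))) (s≤s z≤n))

  -- The cut bound needs a vertex outside the part; `surplus` provides a second part to take it
  -- from.
  outsider : ∀ t → T t → ∃ λ w → ¬ D t w
  outsider t τ with #<#⇒∃ (_≟ t) T? (≤-trans (s≤s (≤-reflexive (#-point t))) (≤-trans (m≤n+m 2 (# S?)) (≤-reflexive (sym surplus))))
  ... | t′ , τ′ , t′≢t with inhabited t′ τ′
  ...   | w , d′ = w , λ d → t′≢t (disjoint t′ t w τ′ τ d′ d)

removeEdge : SimpleGraph n → (x y : Fin n) → SimpleGraph n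
removeEdge G x y = record
  { Adj    = λ a b → Adj G a b × ¬ (a ≡ x × b ≡ y) × ¬ (a ≡ y × b ≡ x)
  ; adj?   = λ a b → adj? G a b ×-dec ¬? (a ≟ x ×-dec b ≟ y) ×-dec ¬? (a ≟ y ×-dec b ≟ x)
  ; sym    = λ (e , p , q) → adj-sym G e , (λ (b≡x , a≡y) → q (a≡y , b≡x)) , (λ (b≡y , a≡x) → p (a≡x , b≡y))
  ; irrefl = λ (e , _) → irrefl G e
  }

module _ (G : SimpleGraph n) (k : ℕ) (even : n ≡ 2 * k)
         (connected : KConnected 3 G) (regular : ∀ v → deg G v ≡ 4) where

  -- Each of the s + 2 parts of a barrier has at least four outgoing edges in `G`, while the s
  -- barrier vertices receive at most 4s of their ends and the removed edge accounts for two more: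
  -- 4s + 8 would be at most 4s + 2.
  avoiding-perfectMatching : ∀ x y → PerfectMatching (removeEdge G x y)
  avoiding-perfectMatching x y = decidable-stable (perfectMatching? G′) λ none → impossible (tutte G′ k even none)
    where
    G′ = removeEdge G x y
    impossible : ¬ Barrier G′
    impossible B = <⇒≱ (n<1+n (# S? * 4 + 2)) (begin
      suc (# S? * 4 + 2)                       ≡⟨ sym (+-suc (# S? * 4) 2) ⟩
      # S? * 4 + 3                             ≤⟨ +-monoʳ-≤ (# S? * 4) (m≤m+n 3 5) ⟩
      # S? * 4 + 8                             ≡⟨ sym (*-distribʳ-+ 4 (# S?) 2) ⟩
      (# S? + 2) * 4                           ≡⟨ cong (_* 4) (sym surplus) ⟩
      # T? * 4                                 ≡⟨ *-comm (# T?) 4 ⟩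
      4 * # T?                                 ≡⟨ sym (sumOver-const T? 4) ⟩
      sumOver T? (const 4)                     ≤⟨ m+n≤o⇒m≤o _ (weigh weight (const 4) heavy) ⟩
      sum weight                               ≡⟨ trans (∑-distrib-+ intoS _) (cong (sum intoS +_) (∑-distrib-+ _ _)) ⟩
      sum intoS + (# (_≟ x) + # (_≟ y))        ≡⟨ cong₂ _+_ (sum-degree-into G′ S?) (cong₂ _+_ (#-point x) (#-point y)) ⟩
      sumOver S? (deg G′) + 2                  ≤⟨ +-monoˡ-≤ 2 (sumOver-mono S? λ v _ → ≤-trans (#-mono (adj? G′ v) (adj? G v) (λ _ → proj₁)) (≤-reflexive (regular v))) ⟩
      sumOver S? (const 4) + 2                 ≡⟨ cong (_+ 2) (trans (sumOver-const S? 4) (*-comm 4 (# S?))) ⟩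
      # S? * 4 + 2                             ∎)
      where
      open ≤-Reasoning
      open Barrier B
      open BarrierCounting G′ B
      -- The removed edge may leave a part without ending in `S`, so each of its ends carries one
      -- extra unit.
      weight : Fin n → ℕ
      weight v = intoS v + (χ (v ≟ x) + χ (v ≟ y))
      outward≤weight : ∀ t v → T t → D t v → Cut.outward G (D? t) v ≤ weight v
      outward≤weight t v τ d = ≤-trans
        (#-union kept? removed? out? λ u (¬d , a) → classify u ¬d a)
        (+-mono-≤ (outward≤intoS t τ d) (≤-trans (#-union xy? yx? removed? (λ u → id))
          (+-mono-≤ (≤-reflexive (point v x y)) (≤-reflexive (point v y x)))))
        where
        out? kept? xy? yx? removed? : Decidable _
        out? u = ¬? (D? t u) ×-dec adj? G v u
        kept? u = ¬? (D? t u) ×-dec adj? G′ v u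
        xy? u = v ≟ x ×-dec u ≟ y
        yx? u = v ≟ y ×-dec u ≟ x
        removed? u = xy? u ⊎-dec yx? u
        point : ∀ v x y → # (λ u → v ≟ x ×-dec u ≟ y) ≡ χ (v ≟ x)
        point v x y = trans (#-guard (v ≟ x) (_≟ y)) (trans (cong (χ (v ≟ x) *_) (#-point y)) (*-identityʳ _))
        classify : ∀ u → ¬ D t u → Adj G v u → (¬ D t u × Adj G′ v u) ⊎ ((v ≡ x × u ≡ y) ⊎ (v ≡ y × u ≡ x))
        classify u ¬d a with toSum (removed? u)
        ... | inj₁ r = inj₂ r
        ... | inj₂ ¬r = inj₁ (¬d , a , ¬r ∘ inj₁ , ¬r ∘ inj₂)
      heavy : ∀ t → T t → 4 ≤ sumOver (D? t) weight
      heavy t τ = let (w , w∉) = outsider t τ in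
        ≤-trans (Cut.quartic-odd-cut G (D? t) connected regular (odd t τ) w w∉)
          (sumOver-mono (D? t) λ v → outward≤weight t v τ)

-- Tripods

two≤# : {P : Fin n → Set} (P? : Decidable P) → ∀ {u v} → P u → P v → u ≢ v → 2 ≤ # P?
two≤# P? {u} {v} p q u≢v = subst (_≤ # P?) (cong₂ _+_ (#-point u) (#-point v))
  (#-excl (_≟ u) (_≟ v) P? (λ { _ refl → p }) (λ { _ refl → q }) λ { _ (refl , u≡v) → u≢v u≡v })

-- The shape of a barrier of a cubic graph H on at most 18 vertices: three odd parts hanging off one vertex c.
record Tripod (H K : SimpleGraph n) : Set₁ where
  field
    H⊆K      : ∀ {u v} → Adj H u v → Adj K u v
    c        : Fin n
    T        : Fin n → Set
    D        : Fin n → Fin n → Set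
    T?       : Decidable T
    D?       : ∀ t → Decidable (D t)
    center   : ∀ t → T t → ¬ D t c
    disjoint : ∀ t t′ v → T t → T t′ → D t v → D t′ v → t ≡ t′
    closed   : ∀ t {v u} → T t → D t v → Adj K v u → u ≢ c → D t u
    cover    : ∀ v → v ≢ c → ∃ λ t → T t × D t v
    three    : # T? ≡ 3
    5≤size   : ∀ t → T t → 5 ≤ # (D? t)
    size≤7   : ∀ t → T t → # (D? t) ≤ 7
    leg      : ∀ t → T t → ∃ λ v → D t v × Adj H v c
    thin     : ∀ t → T t → Cut.cut H (D? t) ≤ 1

  leg-unique : ∀ t → T t → ∀ {u v} → D t u → D t v → Adj H u c → Adj H v c → u ≡ v
  leg-unique t τ {u} {v} d d′ uc vc = decidable-stable (u ≟ v) λ u≢v →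
    <⇒≱ (two≤# (boundary? H (D? t)) (d , c , center t τ , uc) (d′ , c , center t τ , vc) u≢v)
      (≤-trans (boundary≤cut H (D? t)) (thin t τ))
    where open Cut

-- Barriers of a cubic graph on at most 18 vertices

module CubicBarrier {H K : SimpleGraph n} (n≤18 : n ≤ 18) (cubic : ∀ v → deg H v ≡ 3)
                    (H⊆K : ∀ {u v} → Adj H u v → Adj K u v) (B : Barrier K) where
  open Barrier B
  open BarrierCounting H (barrier-antitone H⊆K B)
  open Cut H

  private
    s m : ℕ
    s = # S?
    large? : ∀ t → Dec (5 ≤ # (D? t))
    large? t = 5 ≤? # (D? t)
    m = sumOver T? (λ t → χ (large? t))

  sum-intoS : sum intoS ≡ 3 * s
  sum-intoS = trans (sum-degree-into H S?) (trans (sum-cong-≗ λ v → cong (χ (S? v) *_) (cubic v)) (sumOver-const S? 3))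

  cut≤intoS : ∀ t → T t → cut (D? t) ≤ sumOver (D? t) intoS
  cut≤intoS t τ = sumOver-mono (D? t) λ v → outward≤intoS t τ

  sizes : (w : Fin n → ℕ) → (∀ t → T t → w t ≤ # (D? t)) → sumOver T? w + s ≤ 18
  sizes w w≤ = ≤-trans (≤-reflexive (cong (sumOver T? w +_) (sym (trans (sumOver-const S? 1) (*-identityˡ s)))))
    (≤-trans (weigh (const 1) w λ t τ → ≤-trans (w≤ t τ) (≤-reflexive (sym (trans (sumOver-const (D? t) 1) (*-identityˡ _)))))
      (≤-trans (≤-reflexive (trans (sum-const 1) (*-identityʳ n))) n≤18))

  affine : ∀ a b → sumOver T? (λ t → a + b * χ (large? t)) ≡ a * (s + 2) + b * m
  affine a b = trans (sumOver-+ T? (const a) _) (cong₂ _+_ (trans (sumOver-const T? a) (cong (a *_) surplus))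
    (trans (sum-cong-≗ λ t → shuffle (χ (T? t)) b (χ (large? t))) (sym (*-distribˡ-sum b _))))
    where
    shuffle : ∀ x y z → x * (y * z) ≡ y * (x * z)
    shuffle = solve-∀

  -- The s + 2 parts share at most 3s edges into `S`, and `cubic-small-cut` asks three edges of each
  -- part with a discount of 2 for a large one, so 3(s + 2) is at most 3s + 2m.
  3≤m : 3 ≤ m
  3≤m = *-cancelˡ-≤ 2 (+-cancelˡ-≤ (3 * s) 6 (2 * m) (begin
    3 * s + 6                          ≡⟨ sym (*-distribˡ-+ 3 s 2) ⟩
    3 * (s + 2)                        ≡⟨ trans (cong (3 *_) (sym surplus)) (sym (sumOver-const T? 3)) ⟩
    sumOver T? (const 3)               ≤⟨ sumOver-mono T? (λ t τ → Cut.cubic-small-cut H (D? t) cubic (odd t τ)) ⟩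
    sumOver T? (λ t → cut (D? t) + 2 * χ (large? t)) ≡⟨ sumOver-+ T? _ _ ⟩
    sumOver T? (λ t → cut (D? t)) + sumOver T? (λ t → 2 * χ (large? t))
                                       ≤⟨ +-mono-≤ (m+n≤o⇒m≤o _ (weigh intoS _ cut≤intoS)) (≤-reflexive (affine 0 2)) ⟩
    sum intoS + 2 * m                  ≡⟨ cong (_+ 2 * m) sum-intoS ⟩
    3 * s + 2 * m                      ∎))
    where open ≤-Reasoning

  m≤s+2 : m ≤ s + 2
  m≤s+2 = ≤-trans (sumOver-mono T? λ t _ → χ≤1 (large? t)) (≤-reflexive (trans (sumOver-const T? 1) (trans (*-identityˡ _) surplus)))

  1≤s : 1 ≤ s
  1≤s = +-cancelʳ-≤ 2 1 s (≤-trans 3≤m m≤s+2)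

  large-size : ∀ a b → a + b ≤ 5 → (∀ t → T t → a ≤ # (D? t)) → a * (s + 2) + b * m + s ≤ 18
  large-size a b a+b≤5 a≤ = subst (λ z → z + s ≤ 18) (affine a b) (sizes _ bound)
    where
    bound : ∀ t → T t → a + b * χ (large? t) ≤ # (D? t)
    bound t τ with large? t
    ... | yes big = ≤-trans (≤-reflexive (cong (a +_) (*-identityʳ b))) (≤-trans a+b≤5 big)
    ... | no _ = ≤-trans (≤-reflexive (trans (cong (a +_) (*-zeroʳ b)) (+-identityʳ a))) (a≤ t τ)

  -- Three vertices in `S` would bring five parts, three of them with at least 5 vertices: 5 + 12 +
  -- 3 = 20 vertices in all.
  s≤2 : s ≤ 2
  s≤2 = ≮⇒≥ λ 3≤s → <⇒≱ (≤-trans (+-mono-≤ (+-mono-≤ (*-monoʳ-≤ 1 (+-monoˡ-≤ 2 3≤s)) (*-monoʳ-≤ 4 3≤m)) 3≤s)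
    (large-size 1 4 ≤-refl λ t τ → subst (1 ≤_) (sym (proj₂ (odd t τ))) (s≤s z≤n))) (m≤m+n 18 1)

  -- A single vertex would need three neighbours in S.
  3≤size : ∀ t → T t → 3 ≤ # (D? t)
  3≤size t τ with odd t τ
  ... | suc k , eq = subst (3 ≤_) (sym eq) (s≤s (s≤s (≤-trans (s≤s z≤n) (m≤n+m (suc k) k))))
  ... | zero , eq = contradiction (begin
    3                             ≡⟨ sym (singleton-cut (D? t) 3 cubic eq) ⟩
    cut (D? t)                    ≤⟨ cut≤intoS t τ ⟩
    sumOver (D? t) intoS          ≤⟨ sumOver-mono (D? t) (λ v _ → #-mono (λ u → S? u ×-dec adj? H v u) S? (λ _ → proj₁)) ⟩
    sumOver (D? t) (const s)      ≡⟨ trans (sumOver-const (D? t) s) (trans (cong (s *_) eq) (*-identityʳ s)) ⟩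
    s                             ≤⟨ s≤2 ⟩
    2                             ∎) λ { (s≤s (s≤s ())) }
    where open ≤-Reasoning

  -- Two vertices in `S` would bring four parts of at least 3 vertices, three of them with at least
  -- 5: 12 + 6 + 2 = 20 vertices in all.
  s≡1 : s ≡ 1
  s≡1 = ≤-antisym (≮⇒≥ λ 2≤s → <⇒≱ (≤-trans (+-mono-≤ (+-mono-≤ (*-monoʳ-≤ 3 (+-monoˡ-≤ 2 2≤s)) (*-monoʳ-≤ 2 3≤m)) 2≤s)
    (large-size 3 2 ≤-refl 3≤size)) (m≤m+n 18 1)) 1≤s

  three : # T? ≡ 3
  three = trans surplus (cong (_+ 2) s≡1)

  5≤size : ∀ t → T t → 5 ≤ # (D? t)
  5≤size t τ = decidable-stable (large? t) λ ¬large → <⇒≱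
    (subst₂ _<_ (sum-cong-≗ λ t → χ-× (T? t) (large? t)) three
      (#-mono-< (λ t → T? t ×-dec large? t) T? (λ _ → proj₁) t τ (¬large ∘ proj₂))) 3≤m

  c : Fin n
  c = proj₁ (0<#⇒∃ S? 1≤s)

  c∈S : S c
  c∈S = proj₂ (0<#⇒∃ S? 1≤s)

  S⇒≡c : ∀ {v} → S v → v ≡ c
  S⇒≡c {v} v∈S = decidable-stable (v ≟ c) λ v≢c → <⇒≱ (two≤# S? v∈S c∈S v≢c) (≤-reflexive s≡1)

  one-heavier : ∀ t → T t → ∀ a b → sumOver T? (λ t′ → a + b * χ (t′ ≟ t)) ≡ a * 3 + b
  one-heavier t τ a b = trans (sumOver-+ T? (const a) _) (cong₂ _+_ (trans (sumOver-const T? a) (cong (a *_) three))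
    (trans (sum-cong-≗ λ t′ → shuffle (χ (T? t′)) b (χ (t′ ≟ t))) (trans (sum-point t (λ t′ → χ (T? t′) * b))
      (trans (cong (_* b) (χ-yes (T? t) τ)) (*-identityˡ b)))))
    where
    shuffle : ∀ x y z → x * (y * z) ≡ z * (x * y)
    shuffle = solve-∀

  heavier-bound : ∀ {f : Fin n → ℕ} t a b → (∀ t′ → T t′ → a ≤ f t′) → a + b ≤ f t →
                  ∀ t′ → T t′ → a + b * χ (t′ ≟ t) ≤ f t′
  heavier-bound t a b a≤ a+b≤ t′ τ′ with t′ ≟ t
  ... | yes refl = ≤-trans (≤-reflexive (cong (a +_) (*-identityʳ b))) a+b≤
  ... | no _ = ≤-trans (≤-reflexive (trans (cong (a +_) (*-zeroʳ b)) (+-identityʳ a))) (a≤ t′ τ′)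

  -- A part of 8 vertices, two of 5 and the center would make 19.
  size≤7 : ∀ t → T t → # (D? t) ≤ 7
  size≤7 t τ = ≮⇒≥ λ 8≤ → <⇒≱ (≤-trans (≤-reflexive (cong₂ _+_ (sym (one-heavier t τ 5 3)) (sym s≡1)))
    (sizes _ (heavier-bound t 5 3 5≤size 8≤))) ≤-refl

  1≤cut : ∀ t → T t → 1 ≤ cut (D? t)
  1≤cut t τ = let (_ , eq) = cubic-odd-cut (D? t) cubic (odd t τ) in subst (1 ≤_) (sym eq) (s≤s z≤n)

  -- The center has three edges in `H`, and each of the three parts takes at least one by parity.
  thin : ∀ t → T t → cut (D? t) ≤ 1
  thin t τ = ≮⇒≥ λ 2≤ → <⇒≱ (begin
    4                                          ≡⟨ sym (one-heavier t τ 1 1) ⟩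
    sumOver T? (λ t′ → 1 + 1 * χ (t′ ≟ t))     ≤⟨ m+n≤o⇒m≤o _ (weigh intoS _ λ t′ τ′ → ≤-trans (heavier-bound t 1 1 1≤cut 2≤ t′ τ′) (cut≤intoS t′ τ′)) ⟩
    sum intoS                                  ≡⟨ trans sum-intoS (cong (3 *_) s≡1) ⟩
    3                                          ∎) ≤-refl
    where open ≤-Reasoning

  leg : ∀ t → T t → ∃ λ v → D t v × Adj H v c
  leg t τ = decidable-stable (any? λ v → D? t v ×-dec adj? H v c) λ none → <⇒≱ (1≤cut t τ)
    (≤-trans (cut≤intoS t τ) (≤-trans (sumOver-mono (D? t) {g = const 0} λ v d → ≤-reflexive (sum-zero λ u →
      χ-no (S? u ×-dec adj? H v u) λ (u∈S , a) → none (v , d , subst (Adj H v) (S⇒≡c u∈S) a))) (≤-reflexive (sumOver-const (D? t) 0))))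

  part-closed : ∀ t {v u} → T t → D t v → Adj K v u → u ≢ c → D t u
  part-closed t τ d a u≢c = closed t τ d a (u≢c ∘ S⇒≡c)

  -- The closed neighbourhood of an uncovered vertex has four vertices, all outside the parts.
  cover : ∀ v → v ≢ c → ∃ λ t → T t × D t v
  cover v v≢c = decidable-stable (any? λ t → T? t ×-dec D? t v) λ none → <⇒≱ (begin
    5 * 3 + 4                                        ≡⟨ sym (cong₂ _+_ (trans (sumOver-const T? 5) (cong (5 *_) three))
                                                          (cong₂ _+_ (cubic v) (#-point v))) ⟩
    sumOver T? (const 5) + (deg H v + # (_≟ v))      ≤⟨ +-mono-≤ (sumOver-mono T? 5≤) (#-excl (adj? H v) (_≟ v) near? (λ _ → inj₁) (λ _ → inj₂) (λ { _ (a , refl) → irrefl H a })) ⟩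
    sumOver T? (λ t → sumOver (D? t) (const 1)) + # near?  ≡⟨ cong (sumOver T? _ +_) (sym (trans (sumOver-const near? 1) (*-identityˡ _))) ⟩
    sumOver T? (λ t → sumOver (D? t) (const 1)) + sumOver near? (const 1)
                                                     ≤⟨ packing T? near? D? (λ t u τ d → avoid-near none t u τ d) disjoint (const 1) ⟩
    sum {n} (const 1)                                ≡⟨ trans (sum-const 1) (*-identityʳ n) ⟩
    n                                                ≤⟨ n≤18 ⟩
    18                                               ∎) ≤-refl
    where
    open ≤-Reasoning
    near? : Decidable (λ u → Adj H v u ⊎ u ≡ v)
    near? u = adj? H v u ⊎-dec u ≟ v
    5≤ : ∀ t → T t → 5 ≤ sumOver (D? t) (const 1)
    5≤ t τ = ≤-trans (5≤size t τ) (≤-reflexive (sym (trans (sumOver-const (D? t) 1) (*-identityˡ _))))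
    avoid-near : ¬ (∃ λ t → T t × D t v) → ∀ t u → T t → D t u → ¬ (Adj H v u ⊎ u ≡ v)
    avoid-near none t u τ d (inj₁ a) = none (t , τ , part-closed t τ d (H⊆K (adj-sym H a)) v≢c)
    avoid-near none t u τ d (inj₂ refl) = none (t , τ , d)

  tripod : Tripod H K
  tripod = record
    { H⊆K = H⊆K ; c = c ; T = T ; D = D ; T? = T? ; D? = D? ; center = λ t τ d → avoid t c τ d c∈S
    ; disjoint = disjoint ; closed = part-closed ; cover = cover ; three = three
    ; 5≤size = 5≤size ; size≤7 = size≤7 ; leg = leg ; thin = thin }

-- Two tripods of one cubic graph

module _ (H : SimpleGraph n) (cubic : ∀ v → deg H v ≡ 3) (c : Fin n) {P : Fin n → Set} (P? : Decidable P)
         (closed : ∀ {v u} → P v → Adj H v u → u ≢ c → P u)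
         (unique : ∀ {u v} → P u → P v → Adj H u c → Adj H v c → u ≡ v) where

  private
    closed-neighbourhood : ∀ w → P w → ¬ Adj H w c → 4 ≤ # P?
    closed-neighbourhood w p ¬wc = subst (_≤ # P?) (cong₂ _+_ (cubic w) (#-point w))
      (#-excl (adj? H w) (_≟ w) P? (λ u a → closed p a λ { refl → ¬wc a }) (λ { _ refl → p }) λ { _ (a , refl) → irrefl H a })

  -- P contains the closed neighbourhood of one of its vertices not adjacent to c.
  4≤pocket : ∀ v → P v → 4 ≤ # P?
  4≤pocket v p with adj? H v c
  ... | no ¬vc = closed-neighbourhood v p ¬vc
  ... | yes vc with #<#⇒∃ (_≟ c) (adj? H v) (subst₂ _<_ (sym (#-point c)) (sym (cubic v)) (s≤s (s≤s z≤n)))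
  ...   | w , vw , w≢c = closed-neighbourhood w (closed p vw w≢c) λ wc → adj-≢ H vw (unique p (closed p vw w≢c) vc wc)

module Uncross {H K K′ : SimpleGraph n} (cubic : ∀ v → deg H v ≡ 3) (A : Tripod H K) (A′ : Tripod H K′) where
  open Tripod A
  open Tripod A′ using () renaming
    (c to c′; T to T′; D to D′; D? to D′?; cover to cover′; disjoint to disjoint′; closed to closed′; H⊆K to H⊆K′; size≤7 to size′≤7)

  -- If `A′` split `D t`, there would be two pieces. An edge of `H` leaving a piece can only go to
  -- `c`, because `c′` lies outside `D t`, and only one vertex of `D t` is adjacent to `c`. So
  -- `4≤pocket` gives each piece four vertices, more than the 7 available.
  part-in-part : ∀ {t t′ u v} → T t → ¬ D t c′ → T′ t′ → D t u → D t v → D′ t′ u → D′ t′ v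
  part-in-part {t} {t′} {u} {v} τ c′∉ τ′ du dv d′u = decidable-stable (D′? t′ v) λ v∉ →
    let (t″ , τ″ , d″v) = cover′ v λ { refl → c′∉ dv } in
    <⇒≱ (s≤s (size≤7 t τ)) (≤-trans (+-mono-≤ (common τ′ u du d′u) (common τ″ v dv d″v))
          (#-excl (λ w → D? t w ×-dec D′? t′ w) (λ w → D? t w ×-dec D′? t″ w) (D? t) (λ _ → proj₁) (λ _ → proj₁)
            λ w ((_ , d′) , _ , d″) → v∉ (subst (λ z → D′ z v) (disjoint′ t″ t′ w τ″ τ′ d″ d′) d″v)))
    where
    common : ∀ {t″} → T′ t″ → ∀ w → D t w → D′ t″ w → 4 ≤ # (λ w → D? t w ×-dec D′? t″ w)
    common {t″} τ″ w d d″ = 4≤pocket H cubic c (λ w → D? t w ×-dec D′? t″ w)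
      (λ (d , d″) a u≢c → let du = closed t τ d (H⊆K a) u≢c in
        du , closed′ t″ τ″ d″ (H⊆K′ a) λ { refl → c′∉ du })
      (λ (d , _) (e , _) → leg-unique t τ d e) w (d , d″)

  two-parts-in-part : ∀ {t₁ t₂ t′ u v} → T t₁ → T t₂ → t₁ ≢ t₂ → T′ t′ → ¬ D t₁ c′ → ¬ D t₂ c′ →
                      D t₁ u → D t₂ v → D′ t′ u → ¬ D′ t′ v
  two-parts-in-part {t₁} {t₂} {t′} τ₁ τ₂ t₁≢t₂ τ′ c′∉₁ c′∉₂ d₁ d₂ d′u d′v = <⇒≱ 7<10
    (≤-trans (+-mono-≤ (5≤size t₁ τ₁) (5≤size t₂ τ₂)) (≤-trans
      (#-excl (D? t₁) (D? t₂) (D′? t′) (λ w d → part-in-part τ₁ c′∉₁ τ′ d₁ d d′u) (λ w d → part-in-part τ₂ c′∉₂ τ′ d₂ d d′v)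
        λ w (e₁ , e₂) → t₁≢t₂ (disjoint t₁ t₂ w τ₁ τ₂ e₁ e₂))
      (size′≤7 t′ τ′)))
    where
    7<10 : 7 < 10
    7<10 = m≤m+n 8 2

  -- If the centers agree, the edge itself puts `x` and `y` into one part of `A′`. Otherwise let
  -- `t₀` be the part of `A` holding `c′`: the legs of the other two parts are adjacent to `c`, so
  -- both lie in the part of `A′` that holds `c`. Either way one part of `A′` meets two parts of `A`
  -- that avoid `c′`.
  no-crossing : ∀ {t₁ t₂ x y} → T t₁ → T t₂ → t₁ ≢ t₂ → D t₁ x → D t₂ y → ¬ Adj K′ x y
  no-crossing {t₁} {t₂} {x} {y} τ₁ τ₂ t₁≢t₂ dx dy xy with c ≟ c′
  ... | yes refl =
        let (t′ , τ′ , d′) = cover′ x λ { refl → center t₁ τ₁ dx }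
        in two-parts-in-part τ₁ τ₂ t₁≢t₂ τ′ (center t₁ τ₁) (center t₂ τ₂) dx dy d′
             (closed′ t′ τ′ d′ xy λ { refl → center t₂ τ₂ dy })
  ... | no c≢c′ with cover c′ (c≢c′ ∘ sym) | cover′ c c≢c′
  ...   | t₀ , τ₀ , d₀ | t′ , τ′ , d′ with #<#⇒∃ (_≟ t₀) T? (subst₂ _<_ (sym (#-point t₀)) (sym three) (s≤s (s≤s z≤n)))
  ...     | t₃ , τ₃ , t₃≢t₀ with #<#⇒∃ (λ t → t ≟ t₀ ⊎-dec t ≟ t₃) T? (≤-trans
              (s≤s (≤-trans (#-union (_≟ t₀) (_≟ t₃) (λ t → t ≟ t₀ ⊎-dec t ≟ t₃) λ _ → id)
                (≤-reflexive (cong₂ _+_ (#-point t₀) (#-point t₃))))) (≤-reflexive (sym three)))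
  ...       | t₄ , τ₄ , t₄≢ =
        let (u , du , uc) = leg t₃ τ₃
            (v , dv , vc) = leg t₄ τ₄
        in two-parts-in-part τ₃ τ₄ (t₄≢ ∘ inj₂ ∘ sym) τ′ (avoids τ₃ t₃≢t₀) (avoids τ₄ (t₄≢ ∘ inj₁)) du dv
             (reach uc λ { refl → avoids τ₃ t₃≢t₀ du }) (reach vc λ { refl → avoids τ₄ (t₄≢ ∘ inj₁) dv })
    where
    avoids : ∀ {t} → T t → t ≢ t₀ → ¬ D t c′
    avoids {t} τ t≢t₀ d = t≢t₀ (disjoint t t₀ c′ τ τ₀ d d₀)
    reach : ∀ {w} → Adj H w c → w ≢ c′ → D′ t′ w
    reach wc = closed′ t′ τ′ d′ (H⊆K′ (adj-sym H wc))

-- Removing a perfect matching from a 4-regular graph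

module Complement (G : SimpleGraph n) (connected : KConnected 3 G) (regular : ∀ v → deg G v ≡ 4)
                  (M : PerfectMatching G) where

  private
    p = partner M

    mate-sym : ∀ {a b} → b ≡ p a → a ≡ p b
    mate-sym {a} refl = sym (involutive M a)

  H : SimpleGraph n
  H = record
    { Adj    = λ a b → Adj G a b × b ≢ p a
    ; adj?   = λ a b → adj? G a b ×-dec ¬? (b ≟ p a)
    ; sym    = λ (e , b≢pa) → adj-sym G e , b≢pa ∘ mate-sym
    ; irrefl = irrefl G ∘ proj₁ }

  -- An edge of `M` is named by either of its ends, so a search over vertices runs through all of
  -- `M`.
  plusEdge : Fin n → SimpleGraph n
  plusEdge x = record
    { Adj    = λ a b → Adj G a b × (b ≢ p a ⊎ a ≡ x ⊎ b ≡ x)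
    ; adj?   = λ a b → adj? G a b ×-dec (¬? (b ≟ p a) ⊎-dec a ≟ x ⊎-dec b ≟ x)
    ; sym    = λ (e , h) → adj-sym G e , [ (λ b≢pa → inj₁ (b≢pa ∘ mate-sym)) , [ inj₂ ∘ inj₂ , inj₂ ∘ inj₁ ]′ ]′ h
    ; irrefl = irrefl G ∘ proj₁ }

  H⊆plusEdge : ∀ x {u v} → Adj H u v → Adj (plusEdge x) u v
  H⊆plusEdge x (e , ne) = e , inj₁ ne

  cubic : ∀ v → deg H v ≡ 3
  cubic v = +-cancelˡ-≡ 1 _ _ (begin
    suc (deg H v)             ≡⟨ +-comm 1 (deg H v) ⟩
    deg H v + 1               ≡⟨ cong (deg H v +_) (sym (#-point (p v))) ⟩
    deg H v + # (_≟ p v)      ≡⟨ ≤-antisym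
        (#-excl (adj? H v) (_≟ p v) (adj? G v) (λ _ → proj₁) (λ { _ refl → partner-adj M v }) λ _ ((_ , ne) , eq) → ne eq)
        (#-union (adj? H v) (_≟ p v) (adj? G v) λ u a → [ inj₂ , (λ ne → inj₁ (a , ne)) ]′ (toSum (u ≟ p v))) ⟩
    deg G v                   ≡⟨ regular v ⟩
    4                         ∎)
    where open ≡-Reasoning

  -- A part has one edge of H but at least three edges of G leaving it, and only one edge of M reaches the center.
  module _ {K : SimpleGraph n} (A : Tripod H K) where
    open Tripod A

    crossing-edge : ∃ λ x → ∃₂ λ t t′ → T t × T t′ × t ≢ t′ × D t x × D t′ (p x)
    crossing-edge with 0<#⇒∃ T? (subst (0 <_) (sym three) (s≤s z≤n))
    ... | t , τ with any? (λ v → D? t v ×-dec ¬? (D? t (p v)) ×-dec ¬? (p v ≟ c))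
    ...   | yes (x , d , leaves , px≢c) = let (t′ , τ′ , d′) = cover (p x) px≢c in
            x , t , t′ , τ , τ′ , (λ { refl → leaves d′ }) , d , d′
    ...   | no none = contradiction (begin
      3                                              ≤⟨ Cut.connected⇒cut G (D? t) connected (≤-trans (m≤n+m 3 2) (5≤size t τ)) c (center t τ) ⟩
      Cut.cut G (D? t)                               ≤⟨ sumOver-mono (D? t) split ⟩
      sumOver (D? t) (λ v → Cut.outward H (D? t) v + χ (p v ≟ c))  ≡⟨ sumOver-+ (D? t) _ _ ⟩
      Cut.cut H (D? t) + sumOver (D? t) (λ v → χ (p v ≟ c))        ≤⟨ +-mono-≤ (thin t τ) (≤-trans
           (sum-mono λ v → ≤-trans (*-monoˡ-≤ (χ (p v ≟ c)) (χ≤1 (D? t v))) (≤-reflexive (*-identityˡ _)))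
           (#-subsingleton (λ v → p v ≟ c) λ u v pu pv → trans (sym (involutive M u)) (trans (cong p (trans pu (sym pv))) (involutive M v)))) ⟩
      2                                              ∎) λ { (s≤s (s≤s ())) }
      where
      open ≤-Reasoning
      split : ∀ v → D t v → Cut.outward G (D? t) v ≤ Cut.outward H (D? t) v + χ (p v ≟ c)
      split v d = ≤-trans
        (#-union (λ u → ¬? (D? t u) ×-dec adj? H v u) (λ u → p v ≟ c ×-dec u ≟ p v) (λ u → ¬? (D? t u) ×-dec adj? G v u)
          λ u (¬d , a) → [ (λ { refl → inj₂ (decidable-stable (p v ≟ c) (λ pv≢c → none (v , d , ¬d , pv≢c)) , refl) })
                         , (λ ne → inj₁ (¬d , a , ne)) ]′ (toSum (u ≟ p v)))
        (+-monoʳ-≤ _ (≤-reflexive (trans (#-guard (p v ≟ c) (_≟ p v)) (trans (cong (χ (p v ≟ c) *_) (#-point (p v))) (*-identityʳ _)))))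

  ¬all-tripods : Fin n → ¬ (∀ x → Tripod H (plusEdge x))
  ¬all-tripods v₀ tripod with crossing-edge (tripod v₀)
  ... | x , t , t′ , τ , τ′ , t≢t′ , d , d′ =
    Uncross.no-crossing cubic (tripod v₀) (tripod x) τ τ′ t≢t′ d d′ (partner-adj M x , inj₂ (inj₁ refl))

  one-overlap : ∀ k → n ≡ 2 * k → n ≤ 18 → ∃ λ x → PerfectMatching (plusEdge x)
  one-overlap k even n≤18 = decidable-stable (any? λ x → perfectMatching? (plusEdge x)) λ none →
    ¬all-tripods (fromℕ< (proj₁ connected)) λ x →
      CubicBarrier.tripod n≤18 cubic (H⊆plusEdge x) (tutte (plusEdge x) k even λ M₂ → none (x , M₂))

  admissible : ∀ x → PerfectMatching (plusEdge x) → PerfectMatching (removeEdge G x (p x)) → ThreePMAdmissible G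
  admissible x M₂ M₃ = M , perfectMatching-mono proj₁ M₂ , perfectMatching-mono proj₁ M₃ , disjoint
    where
    disjoint : ∀ v w → p v ≡ w → partner M₂ v ≡ w → partner M₃ v ≡ w → ⊥
    disjoint v w refl e₂ e₃ with proj₂ (partner-adj M₂ v)
    ... | inj₁ off-M = off-M e₂
    ... | inj₂ (inj₁ refl) = proj₁ (proj₂ (partner-adj M₃ v)) (refl , e₃)
    ... | inj₂ (inj₂ to-x) = proj₂ (proj₂ (partner-adj M₃ v))
          (trans (sym (involutive M v)) (cong p (trans (sym e₂) to-x)) , trans e₃ (trans (sym e₂) to-x))

theorem3p2 : ∀ (n : ℕ) (G : SimpleGraph n) → Σ ℕ (λ k → n ≡ 2 * k) → n ≤ 18 →
    KConnected 3 G → Regular 4 G → ThreePMAdmissible G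
theorem3p2 n G (k , even) n≤18 connected regular =
  let (x , M₂) = one-overlap k even n≤18 in admissible x M₂ (avoiding x (partner M₁ x))
  where
  regular′ : ∀ v → deg G v ≡ 4
  regular′ v = trans (sym (degree≡deg G v)) (regular v)
  avoiding : ∀ x y → PerfectMatching (removeEdge G x y)
  avoiding = avoiding-perfectMatching G k even connected regular′
  v₀ : Fin n
  v₀ = fromℕ< (proj₁ connected)
  M₁ : PerfectMatching G
  -- No edge joins `v₀` to itself, so nothing is removed and this is just some perfect matching of
  -- `G`.
  M₁ = perfectMatching-mono proj₁ (avoiding v₀ v₀)
  open Complement G connected regular′ M₁
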